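{- With either GreedySampling or RandomSampling as the local sampler, the algorithm LDP TrieHH with LDP parameter $\varepsilon$ is $\varepsilon$-LDP at item-level.
   Context: **Data.** $\mathcal X$ is a (small, finite) set of characters containing an end-of-sequence symbol $\bot$, and $\mathcal Z=\bigcup_{\ell\ge1}\mathcal X^\ell$ is the set of all possible user contributions. Each contributed element is a string $z=z[1]z[2]\cdots z[\ell]$ with $z[\ell]=\bot$. There is a set $U$ of users; user $j$ holds a local dataset $S_j$, the set of all contributions of that user (a string may be contributed several times). $\mathcal V$ is a list of known words. $z[:m]$ denotes the length-$m$ prefix of $z$, and $z[-1]$ its last character. **LDP.** A randomized mapping $Q$ from an input set to a message space $\mathcal Y$ is an $\varepsilon$-LDP randomizer if for all inputs $S,S'$ and all $y\in\mathcal Y$, $\Pr(Q(S)=y)\le e^{\varepsilon}\Pr(Q(S')=y)$. An algorithm is $\varepsilon$-LDP at item-level if it is a post-processing of messages from $\varepsilon$-LDP randomizers on each contributed item. **Subset Selection** $\mathbf{SS}(z,\mathcal W,\varepsilon)$, for a finite set $\mathcal W$ and $z\in\mathcal W$: let $s=|\mathcal W|$, $d=\lceil s/(e^\varepsilon+1)\rceil$, $p=\frac{de^\varepsilon}{de^\varepsilon+s-d}$. With probability $p$, return $\{z\}$ together with $d-1$ random elements of $\mathcal W\setminus\{z\}$. Otherwise, return $d$ random elements of $\mathcal W\setminus\{z\}$. **Algorithm LDP TrieHH.** Parameters: maximum tree depth $D$, per-layer number of users $N$, user contribution bound $B$, per-layer maximum prefix number $\eta_{\max}$, LDP parameter $\varepsilon$,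 a local sampler, and an extra dummy element $\gamma$. Initialize $H=\emptyset$, $P_0=\mathcal X$. For $i=1,\dots,D$: 1. The server samples a set $U_i$ of $N$ users that have not participated before and broadcasts $P_{i-1}$ to them. Let $\mathcal Z_i=\{zx: z\in P_{i-1},\,x\in\mathcal X\}$. 2. Each user $j\in U_i$ forms $S_j^{[:i+1]}=\{z[:i+1] : z\in S_j,\ z\notin\mathcal V,\ z[:i+1]\in\mathcal Z_i\}$, applies the local sampler to select $B$ elements $\tilde S_j^{[:i+1]}$ from it, and sends to the server the vote vector $\mathbf v_j=\sum_{z\in\tilde S_j^{[:i+1]}}\mathbf 1_{\mathbf{SS}(z,\,\mathcal Z_i\cup\{\gamma\},\,\varepsilon)}$, where $\mathbf 1_A$ is the 0/1 vector indexed by $\mathcal Z_i$ that equals 1 exactly on $A\cap\mathcal Z_i$. 3. The server aggregates $\mathbf v^{U_i}=\sum_{j\in U_i}\mathbf v_j$, lets $\tau_i$ be the value of the $\eta_{\max}$-th largest entry of $\mathbf v^{U_i}$, sets $P_i=\{z\in\mathcal Z_i:\mathbf v^{U_i}[z]\ge\tau_i\}$, and replaces $H$ by $H\cup\{z\in P_i: z[-1]=\bot\}$. The output is $H$. **Local samplers**, selecting $B$ elements from a local dataset $S$. GreedySampling returns the top $B$ elements that are contributed the most. RandomSampling returns a uniformly random subset of $B$ elements from the set of all contributed elements, ignoring the number of times each element is contributed. For both, if $S$ contains fewer than $B$ distinct elements, copies of $\gamma$ are added so that the returned collection always has size $B$. -}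

module Defs where

open import Algebra.Bundles using (CommutativeRing)
import Algebra.Properties.Ring as RingProperties
import Algebra.Properties.Semiring.Exp as SemiringExp
import Algebra.Properties.Semiring.Mult as SemiringMult
open import Data.Bool using (if_then_else_)
open import Data.Fin as Fin using (Fin)
import Data.Fin.Properties as Fin
open import Data.List as List using (List; []; _∷_; [_]; _++_; length; filter; deduplicate; allFin)
import Data.List.Membership.DecPropositional as DecMembership
open import Data.List.Membership.Propositional using (_∈_; _∉_)
import Data.List.Properties as List
open import Data.List.Relation.Binary.Subset.Propositional using (_⊆_)
open import Data.List.Relation.Unary.All using (All; []; _∷_)
import Data.List.Relation.Unary.All as All
import Data.List.Relation.Unary.All.Properties as All
open import Data.List.Relation.Unary.Unique.Propositional using (Unique)
import Data.List.Sort
open import Data.Maybe as Maybe using (Maybe; just; nothing)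
import Data.Maybe.Properties as Maybe
open import Data.Nat as ℕ using (ℕ; zero; suc; _⊓_; _∸_; _!)
import Data.Nat.Properties as ℕ
open import Data.Product using (_×_; _,_; proj₁; proj₂; ∃; Σ-syntax; map₁)
open import Data.Sum using (inj₁; inj₂)
open import Data.Vec as Vec using (Vec; []; _∷_)
open import Data.Vec.Functional as Vector using (Vector)
open import Function using (_∘_; _⇔_; Equivalence)
open import Level using (0ℓ)
open import Relation.Binary using (Rel; IsDecTotalOrder; DecidableEquality)
import Relation.Binary.Construct.Flip.EqAndOrd as Flip
import Relation.Binary.Construct.NonStrictToStrict as NonStrictToStrict
open import Relation.Binary.PropositionalEquality as ≡ using (_≡_; _≢_)
open import Relation.Nullary using (¬_; Dec; yes; no; does; contradiction)
open import Relation.Nullary.Decidable using (¬?)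
open import Relation.Unary using (Pred)

-- The order is decidable, as it is classically.

record CompleteOrderedField : Set₁ where
  infix  4 _≤_
  infix  8 _⁻¹
  field
    commutativeRing : CommutativeRing 0ℓ 0ℓ
  open CommutativeRing commutativeRing public
  field
    _≤_             : Rel Carrier 0ℓ
    isDecTotalOrder : IsDecTotalOrder _≈_ _≤_
    0≉1             : 0# ≉ 1#
    +-monoˡ-≤       : ∀ z {x y} → x ≤ y → x + z ≤ y + z
    *-nonNeg        : ∀ {x y} → 0# ≤ x → 0# ≤ y → 0# ≤ x * y
    -- Total for convenience: the value of 0# ⁻¹ is unspecified.
    _⁻¹             : Carrier → Carrier
    *-inverseʳ      : ∀ {x} → x ≉ 0# → x * x ⁻¹ ≈ 1#

  UpperBound : Pred Carrier 0ℓ → Pred Carrier 0ℓ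
  UpperBound P u = ∀ x → P x → x ≤ u

  field
    complete : (P : Pred Carrier 0ℓ) → ∃ P → ∃ (UpperBound P) →
               ∃ λ l → UpperBound P l × (∀ u → UpperBound P u → l ≤ u)

  open SemiringMult semiring public using () renaming (_×_ to _·_)
  open SemiringExp semiring public using (_^_)
  open NonStrictToStrict _≈_ _≤_ public using (_<_)

  fromℕ : ℕ → Carrier
  fromℕ n = n · 1#

  Converges : (ℕ → Carrier) → Carrier → Set
  Converges a l = ∀ δ → 0# < δ →
    ∃ λ n₀ → ∀ n → n₀ ℕ.≤ n → (l - δ < a n) × (a n < l + δ)

  -- Σ_{k<n} xᵏ / k!
  expSum : Carrier → ℕ → Carrier
  expSum x zero    = 0#
  expSum x (suc n) = expSum x n + x ^ n * fromℕ (n !) ⁻¹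

-- A model of the classical real numbers.  The ceiling and the exponential
-- are not extra structure: in a complete ordered field such functions exist
-- and are uniquely determined by their laws.

record Reals : Set₁ where
  field
    completeOrderedField : CompleteOrderedField
  open CompleteOrderedField completeOrderedField public
  field
    -- Negative numbers have ceiling 0.
    ⌈_⌉      : Carrier → ℕ
    ⌈⌉-least : ∀ x n → ⌈ x ⌉ ℕ.≤ n ⇔ x ≤ fromℕ n
    exp      : Carrier → Carrier
    exp-lim  : ∀ x → Converges (expSum x) (exp x)

module RealProperties (ℝ : Reals) where
  open Reals ℝ
  open RingProperties ring
  module ≤ = IsDecTotalOrder isDecTotalOrder

  x≤y⇒0≤y-x : ∀ {x y} → x ≤ y → 0# ≤ y - x
  x≤y⇒0≤y-x {x} x≤y = ≤.≤-respˡ-≈ (-‿inverseʳ x) (+-monoˡ-≤ (- x) x≤y)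

  +-nonNeg : ∀ {x y} → 0# ≤ x → 0# ≤ y → 0# ≤ x + y
  +-nonNeg {x} {y} 0≤x 0≤y =
    ≤.trans 0≤y (≤.≤-respˡ-≈ (+-identityˡ y) (+-monoˡ-≤ y 0≤x))

  x≤x+y : ∀ {x y} → 0# ≤ y → x ≤ x + y
  x≤x+y {x} {y} 0≤y =
    ≤.≤-respˡ-≈ (+-identityˡ x) (≤.≤-respʳ-≈ (+-comm y x) (+-monoˡ-≤ x 0≤y))

  neg-nonNeg : ∀ {x} → x ≤ 0# → 0# ≤ - x
  neg-nonNeg {x} x≤0 = ≤.≤-respʳ-≈ (+-identityˡ (- x)) (x≤y⇒0≤y-x x≤0)

  0≤1 : 0# ≤ 1#
  0≤1 with ≤.total 0# 1#
  ... | inj₁ 0≤1 = 0≤1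
  ... | inj₂ 1≤0 = ≤.≤-respʳ-≈ -1*-1≈1 (*-nonNeg (neg-nonNeg 1≤0) (neg-nonNeg 1≤0))
    where
    -1*-1≈1 : - 1# * - 1# ≈ 1#
    -1*-1≈1 = trans (-1*x≈-x (- 1#)) (-‿involutive 1#)

  1≰0 : ¬ 1# ≤ 0#
  1≰0 1≤0 = 0≉1 (≤.antisym 0≤1 1≤0)

  fromℕ-nonNeg : ∀ n → 0# ≤ fromℕ n
  fromℕ-nonNeg zero    = ≤.refl
  fromℕ-nonNeg (suc n) = +-nonNeg 0≤1 (fromℕ-nonNeg n)

  fromℕ≉0 : ∀ {n} → n ≢ 0 → fromℕ n ≉ 0#
  fromℕ≉0 {zero}  n≢0 _  = n≢0 ≡.refl
  fromℕ≉0 {suc n} _   eq = 1≰0 (≤.≤-respʳ-≈ eq (x≤x+y (fromℕ-nonNeg n)))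

  fromℕ-mono : ∀ {m n} → m ℕ.≤ n → fromℕ m ≤ fromℕ n
  fromℕ-mono {n = n} ℕ.z≤n = fromℕ-nonNeg n
  fromℕ-mono (ℕ.s≤s {m} {n} m≤n) =
    ≤.≤-respˡ-≈ (+-comm _ _) (≤.≤-respʳ-≈ (+-comm _ _) (+-monoˡ-≤ 1# (fromℕ-mono m≤n)))

  ⁻¹-nonNeg : ∀ {x} → 0# ≤ x → x ≉ 0# → 0# ≤ x ⁻¹
  ⁻¹-nonNeg {x} 0≤x x≉0 with ≤.total 0# (x ⁻¹)
  ... | inj₁ 0≤x⁻¹ = 0≤x⁻¹
  ... | inj₂ x⁻¹≤0 = contradiction 1≤0 1≰0
    where
    0≤-1 : 0# ≤ - 1#
    0≤-1 = ≤.≤-respʳ-≈ (trans (sym (-‿distribʳ-* _ _)) (-‿cong (*-inverseʳ x≉0)))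
                       (*-nonNeg 0≤x (neg-nonNeg x⁻¹≤0))
    1≤0 : 1# ≤ 0#
    1≤0 = ≤.≤-respˡ-≈ (+-identityˡ 1#) (≤.≤-respʳ-≈ (-‿inverseˡ 1#) (+-monoˡ-≤ 1# 0≤-1))

  ^-nonNeg : ∀ {x} → 0# ≤ x → ∀ n → 0# ≤ x ^ n
  ^-nonNeg 0≤x zero    = 0≤1
  ^-nonNeg 0≤x (suc n) = *-nonNeg 0≤x (^-nonNeg 0≤x n)

  expSum-nonNeg : ∀ {x} → 0# ≤ x → ∀ n → 0# ≤ expSum x n
  expSum-nonNeg 0≤x zero    = ≤.refl
  expSum-nonNeg 0≤x (suc n) = +-nonNeg (expSum-nonNeg 0≤x n)
    (*-nonNeg (^-nonNeg 0≤x n)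
      (⁻¹-nonNeg (fromℕ-nonNeg (n !)) (fromℕ≉0 (ℕ.≢-nonZero⁻¹ (n !) {{n ℕ.!≢0}}))))

  exp-nonNeg : ∀ {x} → 0# ≤ x → 0# ≤ exp x
  exp-nonNeg {x} 0≤x with ≤.total 0# (exp x)
  ... | inj₁ 0≤e = 0≤e
  ... | inj₂ e≤0 with exp x ≤.≟ 0#
  ...   | yes e≈0 = ≤.reflexive (sym e≈0)
  ...   | no  e≉0 = contradiction (≤.antisym s≤0 (expSum-nonNeg 0≤x n)) (proj₂ s<0 ∘ λ s≈0 → trans s≈0 (sym e-e))
    where
    0<-e : 0# < - exp x
    0<-e = neg-nonNeg e≤0 , λ 0≈-e → e≉0
      (trans (sym (-‿involutive _)) (trans (-‿cong (sym 0≈-e)) -0#≈0#))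
    n   = proj₁ (exp-lim x (- exp x) 0<-e)
    s<0 = proj₂ (proj₂ (exp-lim x (- exp x) 0<-e) n ℕ.≤-refl)
    e-e : exp x - exp x ≈ 0#
    e-e = -‿inverseʳ (exp x)
    s≤0 : expSum x n ≤ 0#
    s≤0 = ≤.≤-respʳ-≈ e-e (proj₁ s<0)

  module _ {a b : Carrier} (0≤a : 0# ≤ a) (0≤b : 0# ≤ b) where

    ratio-nonNeg : 0# ≤ a * (a + b) ⁻¹
    ratio-nonNeg with (a + b) ≤.≟ 0#
    ... | no  c≉0 = *-nonNeg 0≤a (⁻¹-nonNeg (+-nonNeg 0≤a 0≤b) c≉0)
    ... | yes c≈0 = ≤.reflexive (sym (trans (*-congʳ a≈0) (zeroˡ _)))
      where a≈0 = ≤.antisym (≤.≤-respʳ-≈ c≈0 (x≤x+y 0≤b)) 0≤a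

    ratio≤1 : a * (a + b) ⁻¹ ≤ 1#
    ratio≤1 with (a + b) ≤.≟ 0#
    ... | no  c≉0 = ≤.≤-respʳ-≈ (trans (sym (distribʳ _ a b)) (*-inverseʳ c≉0))
                      (x≤x+y (*-nonNeg 0≤b (⁻¹-nonNeg (+-nonNeg 0≤a 0≤b) c≉0)))
    ... | yes c≈0 = ≤.≤-respˡ-≈ (sym (trans (*-congʳ a≈0) (zeroˡ _))) 0≤1
      where a≈0 = ≤.antisym (≤.≤-respʳ-≈ c≈0 (x≤x+y 0≤b)) 0≤a

combinations : {A : Set} → ℕ → List A → List (List A)
combinations zero    xs       = [ [] ]
combinations (suc k) []       = []
combinations (suc k) (x ∷ xs) = List.map (x ∷_) (combinations k xs) ++ combinations (suc k) xs

combinations≢[] : {A : Set} (k : ℕ) (xs : List A) → k ℕ.≤ length xs →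
                  length (combinations k xs) ≢ 0
combinations≢[] (suc k) (x ∷ xs) (ℕ.s≤s k≤n) eq =
  combinations≢[] k xs k≤n
    (ℕ.m+n≡0⇒m≡0 _
      (≡.trans (≡.sym (≡.trans (List.length-++ (List.map (x ∷_) (combinations k xs)))
                               (≡.cong (ℕ._+ _) (List.length-map (x ∷_) (combinations k xs))))) eq))
combinations≢[] zero xs _ ()

module Probability (ℝ : Reals) where
  open Reals ℝ
  open RealProperties ℝ

  Weighted : Set → Set
  Weighted A = List (Carrier × A)

  total : {A : Set} → Weighted A → Carrier
  total = List.foldr (λ wa t → proj₁ wa + t) 0#

  -- Finitely supported probability distributions; an element may be
  -- listed several times, its weights then add up.

  record Dist (A : Set) : Set where
    field
      outcomes : Weighted A
      nonNeg   : All (λ wa → 0# ≤ proj₁ wa) outcomes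
      total≈1  : total outcomes ≈ 1#

  open Dist public

  Pr : {A : Set} → DecidableEquality A → Dist A → A → Carrier
  Pr _≟_ μ y = total (filter (λ wa → proj₂ wa ≟ y) (outcomes μ))

  Surely : {A : Set} → (A → Set) → Dist A → Set
  Surely P μ = All (λ wa → P (proj₂ wa)) (outcomes μ)

  private
    variable
      A C : Set

    total-++ : (xs ys : Weighted A) → total (xs ++ ys) ≈ total xs + total ys
    total-++ []       ys = sym (+-identityˡ _)
    total-++ (x ∷ xs) ys = trans (+-congˡ (total-++ xs ys)) (sym (+-assoc _ _ _))

  scale : Carrier → Weighted A → Weighted A
  scale w = List.map (map₁ (w *_))

  private
    total-scale : ∀ w (xs : Weighted A) → total (scale w xs) ≈ w * total xs
    total-scale w []       = sym (zeroʳ w)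
    total-scale w (x ∷ xs) = trans (+-congˡ (total-scale w xs)) (sym (distribˡ w _ _))

    scale-nonNeg : ∀ {w} {xs : Weighted A} → 0# ≤ w →
                   All (λ wa → 0# ≤ proj₁ wa) xs → All (λ wa → 0# ≤ proj₁ wa) (scale w xs)
    scale-nonNeg 0≤w []         = []
    scale-nonNeg 0≤w (0≤x ∷ ps) = *-nonNeg 0≤w 0≤x ∷ scale-nonNeg 0≤w ps

  return : A → Dist A
  return a = record
    { outcomes = [ 1# , a ]
    ; nonNeg   = 0≤1 ∷ []
    ; total≈1  = +-identityʳ 1#
    }

  infixl 1 _>>=_
  _>>=_ : Dist A → (A → Dist C) → Dist C
  _>>=_ {A} {C} μ f = record
    { outcomes = bind (outcomes μ)
    ; nonNeg   = bind-nonNeg (nonNeg μ)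
    ; total≈1  = trans (bind-total (outcomes μ)) (total≈1 μ)
    }
    where
    bind : Weighted A → Weighted C
    bind = List.concatMap (λ wa → scale (proj₁ wa) (outcomes (f (proj₂ wa))))

    bind-nonNeg : ∀ {xs} → All (λ wa → 0# ≤ proj₁ wa) xs → All (λ wa → 0# ≤ proj₁ wa) (bind xs)
    bind-nonNeg {[]}           []         = []
    bind-nonNeg {(w , a) ∷ xs} (0≤w ∷ ps) =
      All.++⁺ (scale-nonNeg 0≤w (nonNeg (f a))) (bind-nonNeg ps)

    bind-total : ∀ xs → total (bind xs) ≈ total xs
    bind-total []             = refl
    bind-total ((w , a) ∷ xs) =
      trans (total-++ (scale w (outcomes (f a))) (bind xs))
            (+-cong (trans (total-scale w (outcomes (f a)))
                           (trans (*-congˡ (total≈1 (f a))) (*-identityʳ w)))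
                    (bind-total xs))

  mapM : {n : ℕ} → (A → Dist C) → Vec A n → Dist (Vec C n)
  mapM f []       = return []
  mapM f (x ∷ xs) = f x >>= λ y → mapM f xs >>= λ ys → return (y ∷ ys)

  uniform : (xs : List A) → length xs ≢ 0 → Dist A
  uniform {A} xs xs≢[] = record
    { outcomes = List.map (λ a → w , a) xs
    ; nonNeg   = All.map⁺ (All.universal (λ _ → ⁻¹-nonNeg (fromℕ-nonNeg (length xs)) (fromℕ≉0 xs≢[])) xs)
    ; total≈1  = trans (uniform-total xs) (*-inverseʳ (fromℕ≉0 xs≢[]))
    }
    where
    w = fromℕ (length xs) ⁻¹

    uniform-total : ∀ ys → total (List.map (λ (a : A) → w , a) ys) ≈ fromℕ (length ys) * w
    uniform-total []       = sym (zeroˡ w)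
    uniform-total (y ∷ ys) =
      trans (+-cong (sym (*-identityˡ w)) (uniform-total ys)) (sym (distribʳ w _ _))

  withProbability_then_otherwise_ : (Σ[ p ∈ Carrier ] (0# ≤ p × p ≤ 1#)) → Dist A → Dist A → Dist A
  withProbability p , 0≤p , p≤1 then μ otherwise ν = record
    { outcomes = scale p (outcomes μ) ++ scale (1# - p) (outcomes ν)
    ; nonNeg   = All.++⁺ (scale-nonNeg 0≤p (nonNeg μ)) (scale-nonNeg (x≤y⇒0≤y-x p≤1) (nonNeg ν))
    ; total≈1  =
        trans (total-++ (scale p (outcomes μ)) _)
        (trans (+-cong (scaled p μ) (scaled (1# - p) ν))
        (trans (+-comm p (1# - p))
        (trans (+-assoc 1# (- p) p)
        (trans (+-congˡ (-‿inverseˡ p)) (+-identityʳ 1#)))))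
    }
    where
    scaled : ∀ q κ → total (scale q (outcomes κ)) ≈ q
    scaled q κ = trans (total-scale q (outcomes κ)) (trans (*-congˡ (total≈1 κ)) (*-identityʳ q))

  -- A uniformly random set of k of the listed elements, or all of them
  -- if there are fewer than k.

  randomSubset : ℕ → List A → Dist (List A)
  randomSubset k xs =
    uniform (combinations (k ⊓ length xs) xs)
            (combinations≢[] (k ⊓ length xs) xs (ℕ.m⊓n≤n k (length xs)))

module LDP (ℝ : Reals) where
  open Reals ℝ
  open Probability ℝ

  IsLDP : Carrier → {X Y : Set} → DecidableEquality Y → (X → Dist Y) → Set
  IsLDP ε _≟_ Q = ∀ x x′ y → Pr _≟_ (Q x) y ≤ exp ε * Pr _≟_ (Q x′) y

  -- A randomizer acts on one contributed item, or on the dummy `nothing`.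

  record Randomizer (ε : Carrier) (Item : Set) : Set₁ where
    field
      Message   : Set
      _≟_       : DecidableEquality Message
      randomize : Maybe Item → Dist Message
      isLDP     : IsLDP ε _≟_ randomize

  open Randomizer public using (Message; randomize)

  -- The b items on which a user reports: each slot holds the position of
  -- an item in the dataset, or `nothing`, and no position is used twice.

  record Selection {Item : Set} (S : List Item) (b : ℕ) : Set where
    field
      slots    : Vec (Maybe (Fin (length S))) b
      distinct : ∀ k l {i} → Vec.lookup slots k ≡ just i → Vec.lookup slots l ≡ just i → k ≡ l

  selected : {Item : Set} {S : List Item} {b : ℕ} → Selection S b → Vec (Maybe Item) b
  selected {S = S} σ = Vec.map (Maybe.map (List.lookup S)) (Selection.slots σ)

  -- Sequentially interactive protocols that access the local datasets of
  -- M users only through ε-LDP randomizers, one application per selected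
  -- item; the rest is post-processing by the server.  `asked` lists the
  -- users that have already reported: nobody reports twice, so every
  -- contributed item passes through at most one randomizer, once.  The
  -- number b of reports of a user does not depend on the user's data.

  data Protocol (ε : Carrier) (Item Out : Set) {M : ℕ} (asked : List (Fin M)) : Set₁ where
    output : Out → Protocol ε Item Out asked
    toss   : {A : Set} → Dist A → (A → Protocol ε Item Out asked) → Protocol ε Item Out asked
    ask    : (j : Fin M) → j ∉ asked → (b : ℕ) →
             ((S : List Item) → Dist (Selection S b)) →
             (R : Randomizer ε Item) →
             (Vec (Message R) b → Protocol ε Item Out (j ∷ asked)) →
             Protocol ε Item Out asked

  run : ∀ {ε Item Out M} {asked : List (Fin M)} →
        Protocol ε Item Out asked → (Fin M → List Item) → Dist Out
  run (output o)              S = return o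
  run (toss μ next)           S = μ >>= λ a → run (next a) S
  run (ask j _ b select R next) S =
    select (S j) >>= λ σ →
    mapM (randomize R) (selected σ) >>= λ ms →
    run (next ms) S

  ItemLevelLDP : Carrier → {Item Out : Set} {M : ℕ} → DecidableEquality Out →
                 ((Fin M → List Item) → Dist Out) → Set₁
  ItemLevelLDP ε {Item} {Out} {M} _≟_ 𝒜 =
    Σ[ π ∈ Protocol ε Item Out {M} [] ] (∀ S o → Pr _≟_ (𝒜 S) o ≈ Pr _≟_ (run π S) o)

-- Subset selection over the finite set listed, without repetitions, by W.
-- A subset of W is represented by its elements in the order of W, so that
-- equality of messages is equality of sets.

module SubsetSelection (ℝ : Reals) {A : Set} (_≟_ : DecidableEquality A) where
  open Reals ℝ
  open RealProperties ℝ
  open Probability ℝ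
  open DecMembership _≟_ using (_∈?_)

  asSubset : List A → List A → List A
  asSubset W T = filter (_∈? T) W

  module _ (ε : Carrier) where

    subsetSize : ℕ → ℕ
    subsetSize s = ⌈ fromℕ s * (exp ε + 1#) ⁻¹ ⌉

    inclusionProbability : ℕ → Carrier
    inclusionProbability s = d * exp ε * (d * exp ε + (fromℕ s - d)) ⁻¹
      where d = fromℕ (subsetSize s)

  module _ {ε : Carrier} (0≤ε : 0# ≤ ε) where

    subsetSize≤ : ∀ s → subsetSize ε s ℕ.≤ s
    subsetSize≤ s = Equivalence.from (⌈⌉-least _ s)
      (≤.≤-respʳ-≈ s≈ (x≤x+y (*-nonNeg (*-nonNeg (fromℕ-nonNeg s) (exp-nonNeg 0≤ε)) 0≤c⁻¹)))
      where
      c = exp ε + 1#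
      c≉0 : c ≉ 0#
      c≉0 c≈0 = 1≰0 (≤.≤-respʳ-≈ (trans (+-comm 1# (exp ε)) c≈0) (x≤x+y (exp-nonNeg 0≤ε)))
      0≤c⁻¹ = ⁻¹-nonNeg (+-nonNeg (exp-nonNeg 0≤ε) 0≤1) c≉0
      s≈ : fromℕ s * c ⁻¹ + fromℕ s * exp ε * c ⁻¹ ≈ fromℕ s
      s≈ = trans (sym (distribʳ (c ⁻¹) _ _))
          (trans (*-congʳ (trans (+-congʳ (sym (*-identityʳ _)))
                          (trans (sym (distribˡ (fromℕ s) 1# (exp ε))) (*-congˡ (+-comm 1# (exp ε))))))
          (trans (*-assoc (fromℕ s) c (c ⁻¹))
          (trans (*-congˡ (*-inverseʳ c≉0)) (*-identityʳ _))))

    inclusionProbability-isProbability : ∀ s →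
      0# ≤ inclusionProbability ε s × inclusionProbability ε s ≤ 1#
    inclusionProbability-isProbability s = ratio-nonNeg 0≤de 0≤s-d , ratio≤1 0≤de 0≤s-d
      where
      0≤de  = *-nonNeg (fromℕ-nonNeg (subsetSize ε s)) (exp-nonNeg 0≤ε)
      0≤s-d = x≤y⇒0≤y-x (fromℕ-mono (subsetSize≤ s))

    SS : A → List A → Dist (List A)
    SS z W =
      withProbability inclusionProbability ε s , inclusionProbability-isProbability s
      then      (randomSubset (d ∸ 1) others >>= λ T → return (asSubset W (z ∷ T)))
      otherwise (randomSubset d       others >>= λ T → return (asSubset W T))
      where
      s      = length W
      d      = subsetSize ε s
      others = filter (λ w → ¬? (w ≟ z)) W

-- Local datasets are multisets, represented by lists; `nothing` is the
-- dummy element γ.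

module LocalSampling (ℝ : Reals) {A : Set} (_≟_ : DecidableEquality A) where
  open Probability ℝ

  multiplicity : A → List A → ℕ
  multiplicity z S = length (filter (z ≟_) S)

  distinctElements : List A → List A
  distinctElements = deduplicate _≟_

  record IsTop (B : ℕ) (S T : List A) : Set where
    field
      unique      : Unique T
      contributed : T ⊆ S
      size        : length T ≡ B ⊓ length (distinctElements S)
      top         : ∀ {t u} → t ∈ T → u ∈ S → u ∉ T → multiplicity u S ℕ.≤ multiplicity t S

  -- How ties between equally frequent elements are broken is left open,
  -- and may be random.

  record GreedyRule : Set where
    field
      pick  : ℕ → List A → Dist (List A)
      isTop : ∀ B S → Surely (IsTop B S) (pick B S)

  data LocalSampler : Set where
    GreedySampling : GreedyRule → LocalSampler
    RandomSampling : LocalSampler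

  pad : (B : ℕ) → List A → Vec (Maybe A) B
  pad zero    _        = []
  pad (suc B) []       = nothing ∷ pad B []
  pad (suc B) (x ∷ xs) = just x ∷ pad B xs

  sample : LocalSampler → (B : ℕ) → List A → Dist (Vec (Maybe A) B)
  sample (GreedySampling rule) B S = GreedyRule.pick rule B S >>= λ T → return (pad B T)
  sample RandomSampling        B S = randomSubset B (distinctElements S) >>= λ T → return (pad B T)

-- The alphabet is Fin κ.

String : ℕ → Set
String κ = List (Fin κ)

_≟ˢ_ : {κ : ℕ} → DecidableEquality (String κ)
_≟ˢ_ = List.≡-dec Fin._≟_

_≟ᴴ_ : {κ : ℕ} → DecidableEquality (List (String κ))
_≟ᴴ_ = List.≡-dec _≟ˢ_

EndsIn : {κ : ℕ} → Fin κ → String κ → Set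
EndsIn eos z = List.last z ≡ just eos

endsIn? : {κ : ℕ} (eos : Fin κ) (z : String κ) → Dec (EndsIn eos z)
endsIn? eos z = Maybe.≡-dec Fin._≟_ (List.last z) (just eos)

Contribution : {κ : ℕ} → Fin κ → Set
Contribution {κ} eos = Σ[ z ∈ String κ ] EndsIn eos z

-- Counting from η = 1; the value is 0 if there are fewer than η entries, so
-- that every entry then reaches this threshold.

nthLargest : ℕ → List ℕ → ℕ
nthLargest η xs = Maybe.fromMaybe 0 (List.head (List.drop (η ∸ 1) (sort xs)))
  where open Data.List.Sort (Flip.decTotalOrder ℕ.≤-decTotalOrder) using (sort)

module TrieHH
  (ℝ : Reals)
  {κ : ℕ} (eos : Fin κ) (𝒱 : List (String κ))
  (D N B η : ℕ)
  {ε : Reals.Carrier ℝ} (0≤ε : Reals._≤_ ℝ (Reals.0# ℝ) ε)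
  (sampler : LocalSampling.LocalSampler ℝ (_≟ˢ_ {κ}))
  where

  open Probability ℝ
  open LocalSampling ℝ (_≟ˢ_ {κ})
  open SubsetSelection ℝ (Maybe.≡-dec (_≟ˢ_ {κ}))
  open DecMembership (_≟ˢ_ {κ}) using (_∈?_; _∉?_)
  open DecMembership (Maybe.≡-dec (_≟ˢ_ {κ})) using () renaming (_∈?_ to _∈ᵐ?_)

  extensions : List (String κ) → List (String κ)
  extensions P = List.cartesianProductWith List._∷ʳ_ P (allFin κ)

  -- In layer i, with Z = 𝒵ᵢ.

  localPrefixes : ℕ → List (String κ) → List (Contribution eos) → List (String κ)
  localPrefixes i Z S =
    filter (_∈? Z) (List.map (List.take (suc i)) (filter (_∉? 𝒱) (List.map proj₁ S)))

  Votes : List (String κ) → Set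
  Votes Z = Vector ℕ (length Z)

  _⊕_ : ∀ {n} → Vector ℕ n → Vector ℕ n → Vector ℕ n
  _⊕_ = Vector.zipWith ℕ._+_

  noVotes : ∀ {n} → Vector ℕ n
  noVotes = Vector.replicate _ 0

  indicator : (Z : List (String κ)) → List (Maybe (String κ)) → Votes Z
  indicator Z A k = if does (just (List.lookup Z k) ∈ᵐ? A) then 1 else 0

  userVotes : ℕ → (Z : List (String κ)) → List (Contribution eos) → Dist (Votes Z)
  userVotes i Z S =
    sample sampler B (localPrefixes i Z S) >>= λ S̃ →
    mapM (λ z → SS 0≤ε z (nothing ∷ List.map just Z)) S̃ >>= λ As →
    return (Vec.foldr′ _⊕_ noVotes (Vec.map (indicator Z) As))

  prune : (Z : List (String κ)) → Votes Z → List (String κ)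
  prune Z v = List.map (List.lookup Z) (filter (λ k → τ ℕ.≤? v k) (allFin (length Z)))
    where τ = nthLargest η (Vector.toList v)

  module _ {M : ℕ} (S : Fin M → List (Contribution eos)) where

    open DecMembership (Fin._≟_ {M}) using () renaming (_∉?_ to _∉ᵁ?_)

    aggregateVotes : ℕ → (Z : List (String κ)) → List (Fin M) → Dist (Votes Z)
    aggregateVotes i Z U =
      mapM (λ j → userVotes i Z (S j)) (Vec.fromList U) >>= λ vs →
      return (Vec.foldr′ _⊕_ noVotes vs)

    -- The layers i, …, i + n - 1, given Pᵢ₋₁, the users who have already
    -- participated, and H.

    layers : (n i : ℕ) → List (String κ) → List (Fin M) → List (String κ) → Dist (List (String κ))
    layers zero    i P participated H = return H
    layers (suc n) i P participated H =
      randomSubset N (filter (_∉ᵁ? participated) (allFin M)) >>= λ U →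
      aggregateVotes i Z U >>= λ v →
      layers n (suc i) (prune Z v) (U ++ participated) (H ++ filter (endsIn? eos) (prune Z v))
      where Z = extensions P

    trieHH : Dist (List (String κ))
    trieHH = layers D 1 (List.map [_] (allFin κ)) [] []

{-# OPTIONS --safe #-}

-- A user reports on distinct prefixes, so each sampled prefix can be traced back
-- to an item of its own, and the message about it is subset selection applied to
-- the prefix of that item; everything else is post-processing.  By the absorption
-- identity (k + 1) C(n, k + 1) = (n - k) C(n, k), a subset containing z is exactly
-- exp ε times as likely on input z as one of the same size not containing z, which
-- is the LDP bound once 1 ≤ exp ε.
--
-- Distributions are compared through the expectations of all real functions: in
-- this form the monad laws are linear algebra and need no decidable equality.

module Submission where

open import Defs
import Algebra.Properties.CommutativeSemigroup as CommutativeSemigroupProperties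
import Algebra.Properties.Semiring.Mult as SemiringMult
open import Data.Bool using (if_then_else_)
open import Data.Fin as Fin using (Fin; zero; suc)
import Data.Fin.Properties as Fin
open import Data.List as List using (List; []; _∷_; [_]; _++_; _ʳ++_; length; filter; allFin)
import Data.List.Membership.DecPropositional as DecMembership
open import Data.List.Membership.Propositional using (_∈_; _∉_)
import Data.List.Membership.Propositional.Properties as ∈
import Data.List.Properties as List
open import Data.List.Relation.Binary.Sublist.Propositional as Sublist using ([]; _∷_; _∷ʳ_) renaming (_⊆_ to _⊑_)
import Data.List.Relation.Binary.Sublist.Propositional.Properties as Sublist
open import Data.List.Relation.Binary.Subset.Propositional using (_⊆_)
open import Data.List.Relation.Unary.All using (All; []; _∷_)
import Data.List.Relation.Unary.All as All
import Data.List.Relation.Unary.All.Properties as All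
open import Data.List.Relation.Unary.AllPairs using ([]; _∷_)
open import Data.List.Relation.Unary.Any as Any using (Any; here; there)
import Data.List.Relation.Unary.Any.Properties as Any
import Data.List.Relation.Unary.Unique.DecPropositional.Properties as DecUnique
open import Data.List.Relation.Unary.Unique.Propositional using (Unique)
import Data.List.Relation.Unary.Unique.Propositional.Properties as Unique
open import Data.Maybe as Maybe using (Maybe; just; nothing)
import Data.Maybe.Properties as Maybe
open import Data.Nat as ℕ using (ℕ; zero; suc; _∸_; _⊓_; z≤n; s≤s)
open import Data.Nat.Combinatorics using (_C_; nC1≡n; k>n⇒nCk≡0; nCk+nC[k+1]≡[n+1]C[k+1])
import Data.Nat.Properties as ℕ
open import Data.Nat.Tactic.RingSolver using (solve-∀)
open import Data.Product using (_×_; _,_; proj₁; proj₂; map₁)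
open import Data.Sum using (_⊎_; inj₁; inj₂; [_,_]′)
open import Data.Unit using (⊤; tt)
open import Data.Vec as Vec using (Vec; []; _∷_)
import Data.Vec.Properties as Vec
open import Data.Vec.Relation.Binary.Pointwise.Extensional using (ext; Pointwise-≡⇒≡)
open import Function using (_∘_; id; _⟨_⟩_)
open import Relation.Binary using (DecidableEquality)
open import Relation.Binary.PropositionalEquality as ≡ using (_≡_; _≢_)
import Relation.Binary.Reasoning.Setoid as ≈-Reasoning
open import Relation.Nullary using (¬_; Dec; yes; no; does; contradiction)
open import Relation.Nullary.Decidable using (¬?; _×-dec_; _⊎-dec_; _→-dec_)

-- `Protocol` demands its guarantees for every value that a continuation may receive, whereas the
-- algorithm provides them only for values that it can sample: users that are new and distinct, and
-- prefixes that belong to distinct items. Both conditions are therefore decided inside the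
-- protocol, with a harmless default when they fail, and the output distributions are compared over
-- listed outcomes only. The LDP condition, in contrast, must hold for all items, so the randomizer
-- treats an item with no prefix in the current layer as γ. In subset selection the extreme sizes d
-- = 0 and d = |W| are settled without deciding whether they occur: the branch that would yield a
-- set of the wrong size then has probability 0.

-- Sublists of a repetition-free list as its finite subsets.

module _ {A : Set} where

  length-combinations : ∀ k (xs : List A) → length (combinations k xs) ≡ length xs C k
  length-combinations zero    xs       = ≡.refl
  length-combinations (suc k) []       = ≡.sym (k>n⇒nCk≡0 {0} {suc k} (s≤s z≤n))
  length-combinations (suc k) (x ∷ xs) = begin
    length (List.map (x ∷_) (combinations k xs) ++ combinations (suc k) xs)
      ≡⟨ List.length-++ (List.map (x ∷_) (combinations k xs)) ⟩
    length (List.map (x ∷_) (combinations k xs)) ℕ.+ length (combinations (suc k) xs)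
      ≡⟨ ≡.cong₂ ℕ._+_ (≡.trans (List.length-map (x ∷_) (combinations k xs)) (length-combinations k xs))
                   (length-combinations (suc k) xs) ⟩
    length xs C k ℕ.+ length xs C suc k
      ≡⟨ nCk+nC[k+1]≡[n+1]C[k+1] (length xs) k ⟩
    suc (length xs) C suc k ∎
    where open ≡.≡-Reasoning

  ∈-combinations⁻ : ∀ k (xs : List A) {ys} → ys ∈ combinations k xs → ys ⊑ xs × length ys ≡ k
  ∈-combinations⁻ zero    xs       (here ≡.refl) = Sublist.minimum xs , ≡.refl
  ∈-combinations⁻ (suc k) (x ∷ xs) ys∈ with ∈.∈-++⁻ (List.map (x ∷_) (combinations k xs)) ys∈
  ... | inj₂ ys∈xs = map₁ (x ∷ʳ_) (∈-combinations⁻ (suc k) xs ys∈xs)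
  ... | inj₁ ys∈map with ∈.∈-map⁻ (x ∷_) ys∈map
  ...   | zs , zs∈ , ≡.refl with ∈-combinations⁻ k xs zs∈
  ...     | zs⊑xs , ≡.refl = ≡.refl ∷ zs⊑xs , ≡.refl

  ∈-combinations⁺ : ∀ {xs ys : List A} → ys ⊑ xs → ys ∈ combinations (length ys) xs
  ∈-combinations⁺ []                       = here ≡.refl
  ∈-combinations⁺ {ys = []}    (x ∷ʳ τ)    = here ≡.refl
  ∈-combinations⁺ {ys = _ ∷ _} (x ∷ʳ τ)    = ∈.∈-++⁺ʳ (List.map (x ∷_) _) (∈-combinations⁺ τ)
  ∈-combinations⁺ (≡.refl ∷ τ)             = ∈.∈-++⁺ˡ (∈.∈-map⁺ _ (∈-combinations⁺ τ))

  combinations-unique : ∀ k {xs : List A} → Unique xs → Unique (combinations k xs)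
  combinations-unique zero    _    = [] ∷ []
  combinations-unique (suc k) []   = []
  combinations-unique (suc k) {x ∷ xs} (x∉xs ∷ xs!) =
    Unique.++⁺ (Unique.map⁺ List.∷-injectiveʳ (combinations-unique k xs!)) (combinations-unique (suc k) xs!) disjoint
    where
    disjoint : ∀ {v} → v ∈ List.map (x ∷_) (combinations k xs) × v ∈ combinations (suc k) xs → _
    disjoint (v∈map , v∈) with ∈.∈-map⁻ (x ∷_) v∈map
    ... | zs , _ , ≡.refl =
      All.All¬⇒¬Any x∉xs (Sublist.lookup (proj₁ (∈-combinations⁻ (suc k) xs v∈)) (here ≡.refl))

  ⊑-unique : {xs ys : List A} → xs ⊑ ys → Unique ys → Unique xs
  ⊑-unique []           _            = []
  ⊑-unique (y ∷ʳ τ)     (_ ∷ ys!)    = ⊑-unique τ ys!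
  ⊑-unique (≡.refl ∷ τ) (y∉ys ∷ ys!) = Sublist.All-resp-⊆ τ y∉ys ∷ ⊑-unique τ ys!

  -- Both sublists inherit the order of `ws`, so no freedom is left beyond the choice of elements.
  -- This turns equality of messages into two inclusions.
  ⊑-ext : {ws xs ys : List A} → Unique ws → xs ⊑ ws → ys ⊑ ws → xs ⊆ ys → ys ⊆ xs → xs ≡ ys
  ⊑-ext _            []           []           _ _ = ≡.refl
  ⊑-ext (_ ∷ ws!)    (_ ∷ʳ σ)     (_ ∷ʳ τ)     f g = ⊑-ext ws! σ τ f g
  ⊑-ext (w∉ws ∷ _)   (w ∷ʳ σ)     (≡.refl ∷ τ) f g = contradiction (Sublist.lookup σ (g (here ≡.refl))) (All.All¬⇒¬Any w∉ws)
  ⊑-ext (w∉ws ∷ _)   (≡.refl ∷ σ) (w ∷ʳ τ)     f g = contradiction (Sublist.lookup τ (f (here ≡.refl))) (All.All¬⇒¬Any w∉ws)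
  ⊑-ext (w∉ws ∷ ws!) (≡.refl ∷ σ) (≡.refl ∷ τ) f g = ≡.cong (_ ∷_) (⊑-ext ws! σ τ (tails w∉ws σ f) (tails w∉ws τ g))
    where
    tails : ∀ {w ws xs ys} → All (w ≢_) ws → xs ⊑ ws → w ∷ xs ⊆ w ∷ ys → xs ⊆ ys
    tails w∉ws σ f v∈xs with f (there v∈xs)
    ... | there v∈ys  = v∈ys
    ... | here ≡.refl = contradiction (Sublist.lookup σ v∈xs) (All.All¬⇒¬Any w∉ws)

-- Binomial coefficients.

module _ where
  open import Data.Nat using (_+_; _*_)

  -- (k + 1) C(n, k + 1) = (n - k) C(n, k), with the subtraction moved to the other side.
  C-absorption : ∀ n k → suc k * (n C suc k) + k * (n C k) ≡ n * (n C k)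
  C-absorption zero    zero    = ≡.refl
  C-absorption zero    (suc k) = ≡.cong₂ (λ a b → suc (suc k) * a + suc k * b)
    (k>n⇒nCk≡0 {0} {suc (suc k)} (s≤s z≤n)) (k>n⇒nCk≡0 {0} {suc k} (s≤s z≤n))
    ⟨ ≡.trans ⟩ ≡.cong₂ _+_ (ℕ.*-zeroʳ (suc (suc k))) (ℕ.*-zeroʳ (suc k))
  C-absorption (suc n) zero    = ≡.cong (λ c → c + 0 + 0) (nC1≡n (suc n)) ⟨ ≡.trans ⟩ lemma n
    where
    lemma : ∀ n → suc n + 0 + 0 ≡ suc n * 1
    lemma = solve-∀
  C-absorption (suc n) (suc k) = begin
    suc (suc k) * (suc n C suc (suc k)) + suc k * (suc n C suc k)
      ≡⟨ ≡.cong₂ (λ x y → suc (suc k) * x + suc k * y) (nCk+nC[k+1]≡[n+1]C[k+1] n (suc k)) (nCk+nC[k+1]≡[n+1]C[k+1] n k) ⟨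
    suc (suc k) * (b + c) + suc k * (a + b)
      ≡⟨ regroup k a b c ⟩
    (suc (suc k) * c + suc k * b) + (suc k * b + k * a) + (a + b)
      ≡⟨ ≡.cong₂ (λ x y → x + y + (a + b)) (C-absorption n (suc k)) (C-absorption n k) ⟩
    n * b + n * a + (a + b)
      ≡⟨ collect n a b ⟩
    suc n * (a + b)
      ≡⟨ ≡.cong (suc n *_) (nCk+nC[k+1]≡[n+1]C[k+1] n k) ⟩
    suc n * (suc n C suc k) ∎
    where
    open ≡.≡-Reasoning
    a = n C k
    b = n C suc k
    c = n C suc (suc k)
    regroup : ∀ k a b c → suc (suc k) * (b + c) + suc k * (a + b)
                        ≡ (suc (suc k) * c + suc k * b) + (suc k * b + k * a) + (a + b)
    regroup = solve-∀
    collect : ∀ n a b → n * b + n * a + (a + b) ≡ suc n * (a + b)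
    collect = solve-∀

-- The coefficient counts the sublists of some list of length `n`; a constant list is as good as
-- any.
nCk≢0 : ∀ {n k} → k ℕ.≤ n → n C k ≢ 0
nCk≢0 {n} {k} k≤n eq = combinations≢[] k ns (≡.subst (k ℕ.≤_) (≡.sym |ns|≡n) k≤n)
  (≡.trans (length-combinations k ns) (≡.trans (≡.cong (_C k) |ns|≡n) eq))
  where
  ns = List.replicate n 0
  |ns|≡n = List.length-replicate n

-- Removing one element from a list.

module _ {A : Set} (_≟_ : DecidableEquality A) where

  remove : A → List A → List A
  remove z = filter (λ w → ¬? (w ≟ z))

  ∈-remove⁺ : ∀ {z w} {xs : List A} → w ∈ xs → w ≢ z → w ∈ remove z xs
  ∈-remove⁺ {z} = ∈.∈-filter⁺ (λ w → ¬? (w ≟ z))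

  ∈-remove⁻ : ∀ {z w} {xs : List A} → w ∈ remove z xs → w ∈ xs × w ≢ z
  ∈-remove⁻ {z} = ∈.∈-filter⁻ (λ w → ¬? (w ≟ z))

  remove-⊑ : ∀ z (xs : List A) → remove z xs ⊑ xs
  remove-⊑ z = Sublist.filter-⊆ (λ w → ¬? (w ≟ z))

  remove-mono : ∀ z {xs ys : List A} → xs ⊑ ys → remove z xs ⊑ remove z ys
  remove-mono z = Sublist.filter⁺ _ _ (λ { ≡.refl p → p })

  remove-∉ : ∀ {z} {xs : List A} → z ∉ xs → remove z xs ≡ xs
  remove-∉ z∉xs = List.filter-all _ (All.tabulate λ w∈ w≡z → z∉xs (≡.subst (_∈ _) w≡z w∈))

  length-remove : ∀ {z} {xs : List A} → Unique xs → z ∈ xs → length xs ≡ suc (length (remove z xs))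
  length-remove {z} {x ∷ xs} (x∉xs ∷ xs!) z∈ with x ≟ z
  length-remove {z} {x ∷ xs} (x∉xs ∷ xs!) _            | yes ≡.refl =
    ≡.cong (suc ∘ length) (≡.sym (remove-∉ (All.All¬⇒¬Any x∉xs)))
  length-remove {z} {x ∷ xs} (x∉xs ∷ xs!) (here z≡x)   | no x≢z = contradiction (≡.sym z≡x) x≢z
  length-remove {z} {x ∷ xs} (x∉xs ∷ xs!) (there z∈xs) | no x≢z = ≡.cong suc (length-remove xs! z∈xs)

lookup-injective : {A : Set} {xs : List A} → Unique xs → ∀ {i j} → List.lookup xs i ≡ List.lookup xs j → i ≡ j
lookup-injective (_ ∷ _)      {zero}  {zero}  _  = ≡.refl
lookup-injective (x∉xs ∷ _)   {zero}  {suc j} eq = contradiction eq (All.lookup x∉xs (∈.∈-lookup j))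
lookup-injective (x∉xs ∷ _)   {suc i} {zero}  eq = contradiction (≡.sym eq) (All.lookup x∉xs (∈.∈-lookup i))
lookup-injective (_ ∷ xs!)    {suc i} {suc j} eq = ≡.cong suc (lookup-injective xs! eq)

ʳ++-⊆-++ : {A : Set} (xs : List A) {ys : List A} → xs ʳ++ ys ⊆ xs ++ ys
ʳ++-⊆-++ []       v∈ = v∈
ʳ++-⊆-++ (x ∷ xs) {ys} v∈ with ∈.∈-++⁻ xs (ʳ++-⊆-++ xs {x ∷ ys} v∈)
... | inj₁ v∈xs           = there (∈.∈-++⁺ˡ v∈xs)
... | inj₂ (here v≡x)     = here v≡x
... | inj₂ (there v∈ys)   = there (∈.∈-++⁺ʳ xs v∈ys)

-- Expectations and the monad of finite distributions.

module Expectation (ℝ : Reals) where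
  open Reals ℝ
  open RealProperties ℝ
  open Probability ℝ

  private
    variable
      A X : Set

  weightedSum : Weighted A → (A → Carrier) → Carrier
  weightedSum []             f = 0#
  weightedSum ((w , a) ∷ xs) f = w * f a + weightedSum xs f

  E : Dist A → (A → Carrier) → Carrier
  E μ = weightedSum (outcomes μ)

  weightedSum-++ : ∀ (xs ys : Weighted A) f → weightedSum (xs ++ ys) f ≈ weightedSum xs f + weightedSum ys f
  weightedSum-++ []       ys f = sym (+-identityˡ _)
  weightedSum-++ (x ∷ xs) ys f = trans (+-congˡ (weightedSum-++ xs ys f)) (sym (+-assoc _ _ _))

  weightedSum-scale : ∀ w (xs : Weighted A) f → weightedSum (scale w xs) f ≈ w * weightedSum xs f
  weightedSum-scale w []       f = sym (zeroʳ w)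
  weightedSum-scale w (x ∷ xs) f =
    trans (+-cong (*-assoc w _ _) (weightedSum-scale w xs f)) (sym (distribˡ w _ _))

  E-return : ∀ (a : A) f → E (return a) f ≈ f a
  E-return a f = trans (+-identityʳ _) (*-identityˡ _)

  E->>= : ∀ (μ : Dist A) (k : A → Dist X) f → E (μ >>= k) f ≈ E μ (λ a → E (k a) f)
  E->>= {A} {X} μ k f = go (outcomes μ)
    where
    go : ∀ xs → weightedSum (List.concatMap (λ wa → scale (proj₁ wa) (outcomes (k (proj₂ wa)))) xs) f
              ≈ weightedSum xs (λ a → E (k a) f)
    go []             = refl
    go ((w , a) ∷ xs) = trans (weightedSum-++ (scale w (outcomes (k a))) _ f)
      (+-cong (weightedSum-scale w (outcomes (k a)) f) (go xs))

  -- Facts about the support enter through this lemma: the default values of the protocol lie off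
  -- the listed outcomes and are never compared.
  E-cong-surely : ∀ {P : A → Set} (μ : Dist A) → Surely P μ → ∀ {f g} →
                  (∀ a → P a → f a ≈ g a) → E μ f ≈ E μ g
  E-cong-surely {P = P} μ sure {f} {g} f≈g = go sure
    where
    go : ∀ {xs} → All (P ∘ proj₂) xs → weightedSum xs f ≈ weightedSum xs g
    go []       = refl
    go (p ∷ ps) = +-cong (*-congˡ (f≈g _ p)) (go ps)

  E-cong : ∀ (μ : Dist A) {f g} → (∀ a → f a ≈ g a) → E μ f ≈ E μ g
  E-cong μ f≈g = E-cong-surely μ (All.universal (λ _ → ≡.refl) (outcomes μ)) (λ a (_ : a ≡ a) → f≈g a)

  E->>=-return : ∀ (μ : Dist A) (k : A → X) f → E (μ >>= λ a → return (k a)) f ≈ E μ (f ∘ k)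
  E->>=-return μ k f = trans (E->>= μ (return ∘ k) f) (E-cong μ λ a → E-return (k a) f)

  E-mapM-∷ : ∀ {n} (k : A → Dist X) a (as : Vec A n) f →
             E (mapM k (a ∷ as)) f ≈ E (k a) (λ x → E (mapM k as) (λ xs → f (x ∷ xs)))
  E-mapM-∷ k a as f = trans
    (E->>= (k a) (λ x → mapM k as >>= λ xs → return (x ∷ xs)) f)
    (E-cong (k a) λ x → E->>=-return (mapM k as) (x ∷_) f)

  mapM-map : ∀ {X Y C : Set} (r : Y → Dist C) (g : X → Y) {n} (xs : Vec X n) →
             mapM (r ∘ g) xs ≡ mapM r (Vec.map g xs)
  mapM-map r g []       = ≡.refl
  mapM-map r g (x ∷ xs) = ≡.cong (λ μ → r (g x) >>= λ y → μ >>= λ ys → return (y ∷ ys)) (mapM-map r g xs)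

  E-choice : ∀ p (μ ν : Dist A) f →
             E (withProbability p then μ otherwise ν) f ≈ proj₁ p * E μ f + (1# - proj₁ p) * E ν f
  E-choice (p , _) μ ν f = trans (weightedSum-++ (scale p (outcomes μ)) _ f)
    (+-cong (weightedSum-scale p (outcomes μ) f) (weightedSum-scale (1# - p) (outcomes ν) f))

  𝟙 : ∀ {P : Set} → Dec P → Carrier
  𝟙 P? = if does P? then 1# else 0#

  Pr≈E : ∀ (_≟_ : DecidableEquality A) (μ : Dist A) y → Pr _≟_ μ y ≈ E μ (λ a → 𝟙 (a ≟ y))
  Pr≈E _≟_ μ y = go (outcomes μ)
    where
    go : ∀ xs → total (filter (λ wa → proj₂ wa ≟ y) xs) ≈ weightedSum xs (λ a → 𝟙 (a ≟ y))
    go []             = refl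
    go ((w , a) ∷ xs) with a ≟ y
    ... | yes _ = +-cong (sym (*-identityʳ w)) (go xs)
    ... | no  _ = trans (go xs) (sym (trans (+-congʳ (zeroʳ w)) (+-identityˡ _)))

  surely-uniform : ∀ {P : A → Set} {xs : List A} (xs≢[] : length xs ≢ 0) →
                   (∀ {x} → x ∈ xs → P x) → Surely P (uniform xs xs≢[])
  surely-uniform xs≢[] p = All.map⁺ (All.tabulate p)

  surely-randomSubset : ∀ {P : List A → Set} k {xs : List A} →
                        (∀ {ys} → ys ⊑ xs → P ys) → Surely P (randomSubset k xs)
  surely-randomSubset k {xs} p =
    surely-uniform (combinations≢[] (k ⊓ length xs) xs (ℕ.m⊓n≤n k (length xs)))
      (p ∘ proj₁ ∘ ∈-combinations⁻ (k ⊓ length xs) xs)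

  module _ (_≟_ : DecidableEquality X) (f : A → X) (y : X) where

    private
      indicator : A → Carrier
      indicator a = 𝟙 (f a ≟ y)

    indicator-hit : ∀ {a} → f a ≡ y → indicator a ≈ 1#
    indicator-hit {a} fa≡y with f a ≟ y
    ... | yes _    = refl
    ... | no  fa≢y = contradiction fa≡y fa≢y

    indicator-miss : ∀ {a} → f a ≢ y → indicator a ≈ 0#
    indicator-miss {a} fa≢y with f a ≟ y
    ... | yes fa≡y = contradiction fa≡y fa≢y
    ... | no  _    = refl

    sum-miss : ∀ w (xs : List A) → (∀ {x} → x ∈ xs → f x ≢ y) →
               weightedSum (List.map (w ,_) xs) indicator ≈ 0#
    sum-miss w []       miss = refl
    sum-miss w (x ∷ xs) miss =
      trans (+-cong (trans (*-congˡ (indicator-miss (miss (here ≡.refl)))) (zeroʳ w)) (sum-miss w xs (miss ∘ there)))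
            (+-identityˡ 0#)

    -- Since `x₀` is the only preimage of `y` and is listed once, a single summand survives.
    sum-hit : ∀ w {xs : List A} → Unique xs → ∀ {x₀} → x₀ ∈ xs → f x₀ ≡ y →
              (∀ {x} → x ∈ xs → f x ≡ y → x ≡ x₀) →
              weightedSum (List.map (w ,_) xs) indicator ≈ w
    sum-hit w {x ∷ xs} (x∉xs ∷ _) (here ≡.refl) hit unique =
      trans (+-cong (trans (*-congˡ (indicator-hit hit)) (*-identityʳ w))
                    (sum-miss w xs λ x∈ fx≡y → All.lookup x∉xs x∈ (≡.sym (unique (there x∈) fx≡y))))
            (+-identityʳ w)
    sum-hit w {x ∷ xs} (x∉xs ∷ xs!) (there x₀∈) hit unique =
      trans (+-cong (trans (*-congˡ (indicator-miss λ fx≡y → All.lookup x∉xs x₀∈ (unique (here ≡.refl) fx≡y))) (zeroʳ w))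
                    (sum-hit w xs! x₀∈ hit (unique ∘ there)))
            (+-identityˡ w)

  module _ (_≟_ : DecidableEquality X) (f : List A → X) (y : X)
           {k : ℕ} {xs : List A} (k≤n : k ℕ.≤ length xs) where

    -- The bound `k≤n` undoes the truncation `k ⊓ length xs` in `randomSubset`, which leaves a
    -- uniform choice from `combinations k xs`.
    E-randomSubset-miss : (∀ {T} → T ∈ combinations k xs → f T ≢ y) →
      E (randomSubset k xs) (λ T → 𝟙 (f T ≟ y)) ≈ 0#
    E-randomSubset-miss miss rewrite ℕ.m≤n⇒m⊓n≡m k≤n = sum-miss _≟_ f y _ (combinations k xs) miss

    E-randomSubset-hit : Unique xs → ∀ {T₀} → T₀ ∈ combinations k xs → f T₀ ≡ y →
      (∀ {T} → T ∈ combinations k xs → f T ≡ y → T ≡ T₀) →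
      E (randomSubset k xs) (λ T → 𝟙 (f T ≟ y)) ≈ fromℕ (length xs C k) ⁻¹
    E-randomSubset-hit xs! T₀∈ hit unique
      rewrite ℕ.m≤n⇒m⊓n≡m k≤n | ≡.sym (length-combinations k xs) =
      sum-hit _≟_ f y _ (combinations-unique k xs!) T₀∈ hit unique

-- Arithmetic in the ordered field, and the bound 1 ≤ exp ε.

module OrderedFieldProperties (ℝ : Reals) where
  open Reals ℝ
  open RealProperties ℝ
  open SemiringMult semiring using (×-homo-+; ×1-homo-*)
  open CommutativeSemigroupProperties *-commutativeSemigroup using (x∙yz≈y∙xz)
  open ≈-Reasoning setoid

  *-monoˡ-≤ : ∀ {x y z} → 0# ≤ z → x ≤ y → z * x ≤ z * y
  *-monoˡ-≤ {x} {y} {z} 0≤z x≤y = ≤.≤-respʳ-≈ sum (x≤x+y (*-nonNeg 0≤z (x≤y⇒0≤y-x x≤y)))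
    where
    sum : z * x + z * (y - x) ≈ z * y
    sum = begin
      z * x + z * (y - x)  ≈⟨ distribˡ z x (y - x) ⟨
      z * (x + (y - x))    ≈⟨ *-congˡ (+-comm x (y - x)) ⟩
      z * (y - x + x)      ≈⟨ *-congˡ (+-assoc y (- x) x) ⟩
      z * (y + (- x + x))  ≈⟨ *-congˡ (trans (+-congˡ (-‿inverseˡ x)) (+-identityʳ y)) ⟩
      z * y                ∎

  x≤cx : ∀ {c x} → 1# ≤ c → 0# ≤ x → x ≤ c * x
  x≤cx {c} {x} 1≤c 0≤x =
    ≤.≤-respˡ-≈ (*-identityʳ x) (≤.≤-respʳ-≈ (*-comm x c) (*-monoˡ-≤ 0≤x 1≤c))

  fromℕ-∸ : ∀ m n → fromℕ (m ℕ.+ n) - fromℕ m ≈ fromℕ n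
  fromℕ-∸ m n = begin
    fromℕ (m ℕ.+ n) - fromℕ m       ≈⟨ +-congʳ (×-homo-+ 1# m n) ⟩
    fromℕ m + fromℕ n - fromℕ m     ≈⟨ +-congʳ (+-comm (fromℕ m) (fromℕ n)) ⟩
    fromℕ n + fromℕ m - fromℕ m     ≈⟨ +-assoc _ _ _ ⟩
    fromℕ n + (fromℕ m - fromℕ m)   ≈⟨ trans (+-congˡ (-‿inverseʳ _)) (+-identityʳ _) ⟩
    fromℕ n                         ∎

  -- The term of exponent 0 is 1 and the later ones are nonnegative.
  1≤expSum : ∀ {x} → 0# ≤ x → ∀ n → 1# ≤ expSum x (suc n)
  1≤expSum 0≤x zero    = ≤.reflexive (sym (begin
    0# + 1# * (1# + 0#) ⁻¹  ≈⟨ trans (+-identityˡ _) (*-congʳ (sym (+-identityʳ 1#))) ⟩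
    (1# + 0#) * (1# + 0#) ⁻¹ ≈⟨ *-inverseʳ (fromℕ≉0 {1} λ ()) ⟩
    1#                      ∎))
  1≤expSum 0≤x (suc n) = ≤.trans (1≤expSum 0≤x n) (x≤x+y
    (*-nonNeg (^-nonNeg 0≤x (suc n))
      (⁻¹-nonNeg (fromℕ-nonNeg (suc n ℕ.!)) (fromℕ≉0 (ℕ.≢-nonZero⁻¹ (suc n ℕ.!) {{suc n ℕ.!≢0}})))))

  1≤exp : ∀ {x} → 0# ≤ x → 1# ≤ exp x
  1≤exp {x} 0≤x with ≤.total 1# (exp x)
  ... | inj₁ 1≤e = 1≤e
  ... | inj₂ e≤1 with exp x ≤.≟ 1#
  ...   | yes e≈1 = ≤.reflexive (sym e≈1)
  ...   | no  e≉1 = contradiction (≤.antisym (proj₁ s<e+δ) (≤.≤-respˡ-≈ (sym e+δ≈1) (1≤expSum 0≤x n₀))) (proj₂ s<e+δ)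
    where
    -- If `exp x` were below 1, this gap would push all late partial sums strictly below
    -- `exp x + δ`, which is 1. The index used is `suc n₀` because the empty partial sum is 0.
    δ = 1# - exp x
    e+δ≈1 : exp x + δ ≈ 1#
    e+δ≈1 = begin
      exp x + (1# - exp x)   ≈⟨ +-comm _ _ ⟩
      1# - exp x + exp x     ≈⟨ +-assoc _ _ _ ⟩
      1# + (- exp x + exp x) ≈⟨ trans (+-congˡ (-‿inverseˡ _)) (+-identityʳ _) ⟩
      1#                     ∎
    0<δ : 0# < δ
    0<δ = x≤y⇒0≤y-x e≤1 , λ 0≈δ → e≉1 (trans (sym (+-identityʳ _)) (trans (+-congˡ 0≈δ) e+δ≈1))
    n₀ = proj₁ (exp-lim x δ 0<δ)
    s<e+δ = proj₂ (proj₂ (exp-lim x δ 0<δ) (suc n₀) (ℕ.n≤1+n n₀))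

  ≥1⇒≉0 : ∀ {x} → 1# ≤ x → x ≉ 0#
  ≥1⇒≉0 1≤x x≈0 = 1≰0 (≤.≤-respʳ-≈ x≈0 1≤x)

  1-ratio : ∀ {α β} → α + β ≉ 0# → 1# - α * (α + β) ⁻¹ ≈ β * (α + β) ⁻¹
  1-ratio {α} {β} α+β≉0 = begin
    1# - α * γ                     ≈⟨ +-congʳ (*-inverseʳ α+β≉0) ⟨
    (α + β) * γ - α * γ            ≈⟨ +-congʳ (distribʳ γ α β) ⟩
    α * γ + β * γ - α * γ          ≈⟨ +-congʳ (+-comm _ _) ⟩
    β * γ + α * γ - α * γ          ≈⟨ +-assoc _ _ _ ⟩
    β * γ + (α * γ - α * γ)        ≈⟨ trans (+-congˡ (-‿inverseʳ _)) (+-identityʳ _) ⟩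
    β * γ                          ∎
    where γ = (α + β) ⁻¹

  cross-divide : ∀ {x y a b} → a ≉ 0# → b ≉ 0# → x * b ≈ y * a → x * a ⁻¹ ≈ y * b ⁻¹
  cross-divide {x} {y} {a} {b} a≉0 b≉0 xb≈ya = begin
    x * a ⁻¹                 ≈⟨ *-identityʳ _ ⟨
    x * a ⁻¹ * 1#            ≈⟨ *-congˡ (*-inverseʳ b≉0) ⟨
    x * a ⁻¹ * (b * b ⁻¹)    ≈⟨ swap x (a ⁻¹) b (b ⁻¹) ⟩
    x * b * (a ⁻¹ * b ⁻¹)    ≈⟨ *-congʳ xb≈ya ⟩
    y * a * (a ⁻¹ * b ⁻¹)    ≈⟨ *-congˡ (*-comm _ _) ⟩
    y * a * (b ⁻¹ * a ⁻¹)    ≈⟨ swap y a (b ⁻¹) (a ⁻¹) ⟩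
    y * b ⁻¹ * (a * a ⁻¹)    ≈⟨ *-congˡ (*-inverseʳ a≉0) ⟩
    y * b ⁻¹ * 1#            ≈⟨ *-identityʳ _ ⟩
    y * b ⁻¹                 ∎
    where
    swap : ∀ p q r s → (p * q) * (r * s) ≈ (p * r) * (q * s)
    swap p q r s = trans (*-assoc p q _) (trans (*-congˡ (x∙yz≈y∙xz q r s)) (sym (*-assoc p r _)))

  -- With the upper index written `k + m`, the factor n - k of the absorption identity is just `m`,
  -- and the term `k * c` cancels already in ℕ.
  fromℕ-C-absorption : ∀ k m → fromℕ (suc k) * fromℕ ((k ℕ.+ m) C suc k) ≈ fromℕ m * fromℕ ((k ℕ.+ m) C k)
  fromℕ-C-absorption k m = begin
    fromℕ (suc k) * fromℕ ((k ℕ.+ m) C suc k) ≈⟨ ×1-homo-* (suc k) ((k ℕ.+ m) C suc k) ⟨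
    fromℕ (suc k ℕ.* ((k ℕ.+ m) C suc k))     ≡⟨ ≡.cong fromℕ (ℕ.+-cancelʳ-≡ (k ℕ.* c) _ _ (≡.trans (C-absorption (k ℕ.+ m) k)
                                                   (≡.trans (ℕ.*-distribʳ-+ c k m) (ℕ.+-comm (k ℕ.* c) (m ℕ.* c))))) ⟩
    fromℕ (m ℕ.* c)                           ≈⟨ ×1-homo-* m c ⟩
    fromℕ m * fromℕ c                         ∎
    where c = (k ℕ.+ m) C k

-- The LDP bound for subset selection.

module SubsetSelectionLDP (ℝ : Reals) {A : Set} (_≟_ : DecidableEquality A)
  {ε : Reals.Carrier ℝ} (0≤ε : Reals._≤_ ℝ (Reals.0# ℝ) ε) where
  open Reals ℝ
  open RealProperties ℝ
  open OrderedFieldProperties ℝ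
  open Probability ℝ
  open Expectation ℝ
  open SubsetSelection ℝ _≟_
  open DecMembership _≟_ using (_∈?_)

  _≟ᴸ_ : DecidableEquality (List A)
  _≟ᴸ_ = List.≡-dec _≟_

  open DecMembership _≟ᴸ_ using () renaming (_∈?_ to _∈ᴸ?_)

  private
    e = exp ε

    1≤e : 1# ≤ e
    1≤e = 1≤exp 0≤ε

  -- inclusionProbability, as a function of the subset size as well.
  p : ℕ → ℕ → Carrier
  p d s = fromℕ d * e * (fromℕ d * e + (fromℕ s - fromℕ d)) ⁻¹

  -- At d = 0 the branch that includes `z` would send the singleton of `z`, because `d ∸ 1`
  -- truncates to 0. Its weight vanishes.
  p-zero : ∀ s → p 0 s ≈ 0#
  p-zero s = trans (*-congʳ (zeroˡ e)) (zeroˡ _)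

  -- At d = |W| only d - 1 elements differ from `z`, so the branch that omits `z` would send too
  -- small a set. Its weight vanishes.
  1-p-full : ∀ n → 1# - p (suc n) (suc n) ≈ 0#
  1-p-full n = trans (1-ratio de≉0) (trans (*-congʳ (-‿inverseʳ _)) (zeroˡ _))
    where
    de≉0 : fromℕ (suc n) * e + (fromℕ (suc n) - fromℕ (suc n)) ≉ 0#
    de≉0 = ≥1⇒≉0 (≤.≤-respʳ-≈ (sym (trans (+-congˡ (-‿inverseʳ _)) (+-identityʳ _)))
      (≤.trans (x≤x+y (fromℕ-nonNeg n)) (≤.≤-respʳ-≈ (*-comm _ _) (x≤cx 1≤e (fromℕ-nonNeg (suc n))))))

  -- For |W| = n + 1 and a d-element message y, the probability of SS z W = y is
  -- inWeight if z ∈ y, and outWeight otherwise.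
  inWeight outWeight : ℕ → ℕ → Carrier
  inWeight  d n = p d (suc n) * fromℕ (n C (d ∸ 1)) ⁻¹
  outWeight d n = (1# - p d (suc n)) * fromℕ (n C d) ⁻¹

  -- Put d = k + 1 and n = k + m. Over the common denominator `c`, p is d e and 1 - p is m, so the
  -- claim reduces to d / C(n, d - 1) = m / C(n, d), which is absorption. The bound d ≤ n keeps C(n,
  -- d) nonzero.
  inWeight≈e*outWeight : ∀ {d n} → d ≢ 0 → d ℕ.≤ n → inWeight d n ≈ e * outWeight d n
  inWeight≈e*outWeight {zero} d≢0 _ = contradiction ≡.refl d≢0
  inWeight≈e*outWeight {suc k} {n} _ d≤n with ℕ.m≤n⇒∃[o]m+o≡n (ℕ.≤-trans (ℕ.n≤1+n k) d≤n)
  ... | m , ≡.refl = begin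
      d * e * c ⁻¹ * a ⁻¹        ≈⟨ *-congʳ (trans (*-congʳ (*-comm d e)) (*-assoc e d _)) ⟩
      e * (d * c ⁻¹) * a ⁻¹      ≈⟨ *-assoc e _ _ ⟩
      e * (d * c ⁻¹ * a ⁻¹)      ≈⟨ *-congˡ (swap d (c ⁻¹) (a ⁻¹)) ⟩
      e * (d * a ⁻¹ * c ⁻¹)      ≈⟨ *-congˡ (*-congʳ (cross-divide a≉0 b≉0 (fromℕ-C-absorption k m))) ⟩
      e * (fromℕ m * b ⁻¹ * c ⁻¹) ≈⟨ *-congˡ (swap _ _ _) ⟩
      e * (fromℕ m * c ⁻¹ * b ⁻¹) ≈⟨ *-congˡ (*-congʳ (trans (1-ratio c≉0) (*-congʳ (fromℕ-∸ (suc k) m)))) ⟨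
      e * outWeight (suc k) (k ℕ.+ m) ∎
    where
    open ≈-Reasoning setoid
    d = fromℕ (suc k)
    a = fromℕ ((k ℕ.+ m) C k)
    b = fromℕ ((k ℕ.+ m) C suc k)
    c = d * e + (fromℕ (suc (k ℕ.+ m)) - d)
    a≉0 : a ≉ 0#
    a≉0 = fromℕ≉0 (nCk≢0 (ℕ.m≤m+n k m))
    b≉0 : b ≉ 0#
    b≉0 = fromℕ≉0 (nCk≢0 d≤n)
    c≉0 : c ≉ 0#
    c≉0 = ≥1⇒≉0 (≤.trans (x≤x+y (fromℕ-nonNeg k)) (≤.trans (≤.≤-respʳ-≈ (*-comm e d) (x≤cx 1≤e (fromℕ-nonNeg (suc k))))
      (x≤x+y (≤.≤-respʳ-≈ (sym (fromℕ-∸ (suc k) m)) (fromℕ-nonNeg m)))))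
    swap : ∀ x y z → x * y * z ≈ x * z * y
    swap x y z = trans (*-assoc x y z) (trans (*-congˡ (*-comm y z)) (sym (*-assoc x z y)))

  module _ {W : List A} (W! : Unique W) where

    asSubset-⊑ : ∀ {T} → T ⊑ W → asSubset W T ≡ T
    asSubset-⊑ {T} T⊑W = ⊑-ext W! (Sublist.filter-⊆ (_∈? T) W) T⊑W
      (λ w∈ → proj₂ (∈.∈-filter⁻ (_∈? T) {xs = W} w∈))
      (λ w∈ → ∈.∈-filter⁺ (_∈? T) (Sublist.lookup T⊑W w∈) w∈)

    module _ {z : A} (z∈W : z ∈ W) (y : List A) where

      private
        others  = remove _≟_ z W
        n       = length others
        |W|≡1+n = length-remove _≟_ W! z∈W
        others⊑W = remove-⊑ _≟_ z W
        others! = ⊑-unique others⊑W W!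

        z∉others : z ∉ others
        z∉others z∈ = proj₂ (∈-remove⁻ _≟_ {xs = W} z∈) ≡.refl

      -- Together with `asSubset-remove` this makes adding `z` a bijection from the sublists of
      -- `others` to the sublists of `W` that contain `z`.
      remove-asSubset : ∀ {T} → T ⊑ others → remove _≟_ z (asSubset W (z ∷ T)) ≡ T
      remove-asSubset {T} T⊑ = ⊑-ext W!
        (Sublist.⊆-trans (remove-⊑ _≟_ z _) (Sublist.filter-⊆ (_∈? (z ∷ T)) W)) (Sublist.⊆-trans T⊑ others⊑W) to from
        where
        to : remove _≟_ z (asSubset W (z ∷ T)) ⊆ T
        to w∈ with ∈-remove⁻ _≟_ {xs = asSubset W (z ∷ T)} w∈
        ... | w∈S , w≢z with proj₂ (∈.∈-filter⁻ (_∈? (z ∷ T)) {xs = W} w∈S)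
        ...   | here w≡z  = contradiction w≡z w≢z
        ...   | there w∈T = w∈T
        from : T ⊆ remove _≟_ z (asSubset W (z ∷ T))
        from w∈T with ∈-remove⁻ _≟_ {xs = W} (Sublist.lookup T⊑ w∈T)
        ... | w∈W , w≢z = ∈-remove⁺ _≟_ (∈.∈-filter⁺ (_∈? (z ∷ T)) w∈W (there w∈T)) w≢z

      asSubset-remove : y ⊑ W → z ∈ y → asSubset W (z ∷ remove _≟_ z y) ≡ y
      asSubset-remove y⊑W z∈y = ⊑-ext W! (Sublist.filter-⊆ (_∈? (z ∷ remove _≟_ z y)) W) y⊑W to from
        where
        to : asSubset W (z ∷ remove _≟_ z y) ⊆ y
        to w∈ with proj₂ (∈.∈-filter⁻ (_∈? (z ∷ remove _≟_ z y)) {xs = W} w∈)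
        ... | here ≡.refl = z∈y
        ... | there w∈r   = proj₁ (∈-remove⁻ _≟_ {xs = y} w∈r)
        from : y ⊆ asSubset W (z ∷ remove _≟_ z y)
        from {w} w∈y = ∈.∈-filter⁺ (_∈? (z ∷ remove _≟_ z y)) (Sublist.lookup y⊑W w∈y) w∈z∷r
          where
          w∈z∷r : w ∈ z ∷ remove _≟_ z y
          w∈z∷r with w ≟ z
          ... | yes w≡z = here w≡z
          ... | no  w≢z = there (∈-remove⁺ _≟_ w∈y w≢z)

      Ein Eout : ℕ → Carrier
      Ein  d = E (randomSubset (d ∸ 1) others) (λ T → 𝟙 (asSubset W (z ∷ T) ≟ᴸ y))
      Eout d = E (randomSubset d       others) (λ T → 𝟙 (asSubset W T ≟ᴸ y))

      -- By the bijection, `remove _≟_ z y` is the only preimage of `y` among the C(n, d - 1)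
      -- equally likely choices.
      Ein-hit : ∀ {d} → d ℕ.≤ suc n → y ∈ combinations d W → z ∈ y → Ein d ≈ fromℕ (n C (d ∸ 1)) ⁻¹
      Ein-hit {d} d≤ y∈ z∈y with ∈-combinations⁻ d W y∈
      ... | y⊑W , ≡.refl = E-randomSubset-hit _≟ᴸ_ (λ T → asSubset W (z ∷ T)) y
        (ℕ.∸-monoˡ-≤ 1 d≤) others!
        (≡.subst (λ k → remove _≟_ z y ∈ combinations k others) (≡.cong (_∸ 1) (≡.sym (length-remove _≟_ (⊑-unique y⊑W W!) z∈y)))
          (∈-combinations⁺ (remove-mono _≟_ z y⊑W)))
        (asSubset-remove y⊑W z∈y)
        (λ T∈ eq → ≡.trans (≡.sym (remove-asSubset (proj₁ (∈-combinations⁻ (length y ∸ 1) others T∈)))) (≡.cong (remove _≟_ z) eq))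

      Ein-miss : ∀ {k} → k ℕ.≤ n → ¬ (y ∈ combinations (suc k) W × z ∈ y) → Ein (suc k) ≈ 0#
      Ein-miss {k} k≤n ¬hit = E-randomSubset-miss _≟ᴸ_ (λ T → asSubset W (z ∷ T)) y k≤n λ {T} T∈ → λ { ≡.refl → ¬hit (hit T∈) }
        where
        hit : ∀ {T} → T ∈ combinations k others → asSubset W (z ∷ T) ∈ combinations (suc k) W × z ∈ asSubset W (z ∷ T)
        hit {T} T∈ = ≡.subst (λ l → S ∈ combinations l W) |S| (∈-combinations⁺ S⊑W) , z∈S
          where
          S   = asSubset W (z ∷ T)
          S⊑W = Sublist.filter-⊆ (_∈? (z ∷ T)) W
          z∈S = ∈.∈-filter⁺ (_∈? (z ∷ T)) z∈W (here ≡.refl)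
          T-sub = ∈-combinations⁻ k others T∈
          |S| : length S ≡ suc k
          |S| = ≡.trans (length-remove _≟_ (⊑-unique S⊑W W!) z∈S)
            (≡.cong suc (≡.trans (≡.cong length (remove-asSubset (proj₁ T-sub))) (proj₂ T-sub)))

      y⊑others : ∀ {d} → y ∈ combinations d W → z ∉ y → y ⊑ others × length y ≡ d
      y⊑others {d} y∈ z∉y with ∈-combinations⁻ d W y∈
      ... | y⊑W , |y| = ≡.subst (_⊑ others) (remove-∉ _≟_ z∉y) (remove-mono _≟_ z y⊑W) , |y|

      Eout-hit : ∀ {d} → y ∈ combinations d W → z ∉ y → Eout d ≈ fromℕ (n C d) ⁻¹
      Eout-hit {d} y∈ z∉y with y⊑others {d} y∈ z∉y
      ... | y⊑ , ≡.refl = E-randomSubset-hit _≟ᴸ_ (asSubset W) y (Sublist.length-mono-≤ y⊑) others! (∈-combinations⁺ y⊑)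
        (asSubset-⊑ (Sublist.⊆-trans y⊑ others⊑W))
        (λ T∈ eq → ≡.trans (≡.sym (asSubset-⊑ (Sublist.⊆-trans (proj₁ (∈-combinations⁻ (length y) others T∈)) others⊑W))) eq)

      Eout-miss : ∀ {d} → d ℕ.≤ n → ¬ (y ∈ combinations d W × z ∉ y) → Eout d ≈ 0#
      Eout-miss {d} d≤n ¬hit = E-randomSubset-miss _≟ᴸ_ (asSubset W) y d≤n λ T∈ eq →
        let T⊑ , |T| = ∈-combinations⁻ d others T∈
            T⊑W      = Sublist.⊆-trans T⊑ others⊑W
            T≡y      = ≡.trans (≡.sym (asSubset-⊑ T⊑W)) eq
        in ¬hit (≡.subst (λ T → T ∈ combinations d W × z ∉ T) T≡y
             (≡.subst (λ l → _ ∈ combinations l W) |T| (∈-combinations⁺ T⊑W) , z∉others ∘ Sublist.lookup T⊑))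

      private
        d = subsetSize ε (suc n)

        d≤1+n : d ℕ.≤ suc n
        d≤1+n = subsetSize≤ 0≤ε (suc n)

        p*Ein-miss : ∀ d → d ℕ.≤ suc n → ¬ (y ∈ combinations d W × z ∈ y) → p d (suc n) * Ein d ≈ 0#
        p*Ein-miss zero    _         _    = trans (*-congʳ (p-zero (suc n))) (zeroˡ _)
        p*Ein-miss (suc k) (s≤s k≤n) ¬hit = trans (*-congˡ (Ein-miss k≤n ¬hit)) (zeroʳ _)

        1-p*Eout-miss : ∀ d → d ℕ.≤ suc n → ¬ (y ∈ combinations d W × z ∉ y) → (1# - p d (suc n)) * Eout d ≈ 0#
        1-p*Eout-miss d d≤ ¬hit with ℕ.m≤n⇒m<n∨m≡n d≤
        ... | inj₁ (s≤s d≤n) = trans (*-congˡ (Eout-miss d≤n ¬hit)) (zeroʳ _)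
        ... | inj₂ ≡.refl    = trans (*-congʳ (1-p-full n)) (zeroˡ _)

      -- `SS` computes its size and probability from `length W`. The substitution moves the formula
      -- to `suc n`, where `n` counts the elements other than `z`, as the binomial coefficients do.
      Pr-SS : Pr _≟ᴸ_ (SS 0≤ε z W) y ≈ p d (suc n) * Ein d + (1# - p d (suc n)) * Eout d
      Pr-SS = ≡.subst (λ s → Pr _≟ᴸ_ (SS 0≤ε z W) y ≈
          p (subsetSize ε s) s * Ein (subsetSize ε s) + (1# - p (subsetSize ε s) s) * Eout (subsetSize ε s))
        |W|≡1+n (begin
          Pr _≟ᴸ_ (SS 0≤ε z W) y     ≈⟨ Pr≈E _≟ᴸ_ (SS 0≤ε z W) y ⟩
          E (SS 0≤ε z W) hit         ≈⟨ E-choice (inclusionProbability ε s , inclusionProbability-isProbability 0≤ε s) μ ν hit ⟩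
          p δ s * E μ hit + (1# - p δ s) * E ν hit
            ≈⟨ +-cong (*-congˡ (E->>=-return (randomSubset (δ ∸ 1) others) (λ T → asSubset W (z ∷ T)) hit))
                      (*-congˡ (E->>=-return (randomSubset δ others) (asSubset W) hit)) ⟩
          p δ s * Ein δ + (1# - p δ s) * Eout δ ∎)
        where
        open ≈-Reasoning setoid
        s = length W
        δ = subsetSize ε s
        μ = randomSubset (δ ∸ 1) others >>= λ T → return (asSubset W (z ∷ T))
        ν = randomSubset δ others >>= λ T → return (asSubset W T)
        hit : List A → Carrier
        hit S = 𝟙 (S ≟ᴸ y)

      Pr-SS-in : y ∈ combinations d W → z ∈ y → Pr _≟ᴸ_ (SS 0≤ε z W) y ≈ inWeight d n
      Pr-SS-in y∈ z∈y = trans Pr-SS (trans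
        (+-cong (*-congˡ (Ein-hit {d} d≤1+n y∈ z∈y)) (1-p*Eout-miss d d≤1+n (λ (_ , z∉y) → z∉y z∈y)))
        (+-identityʳ _))

      Pr-SS-out : y ∈ combinations d W → z ∉ y → Pr _≟ᴸ_ (SS 0≤ε z W) y ≈ outWeight d n
      Pr-SS-out y∈ z∉y = trans Pr-SS (trans
        (+-cong (p*Ein-miss d d≤1+n (λ (_ , z∈y) → z∉y z∈y)) (*-congˡ (Eout-hit {d} y∈ z∉y)))
        (+-identityˡ _))

      -- The message type contains all lists, so the LDP bound must also cover those that are no
      -- d-element sublist of `W`.
      Pr-SS-invalid : y ∉ combinations d W → Pr _≟ᴸ_ (SS 0≤ε z W) y ≈ 0#
      Pr-SS-invalid y∉ = trans Pr-SS (trans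
        (+-cong (p*Ein-miss d d≤1+n (y∉ ∘ proj₁)) (1-p*Eout-miss d d≤1+n (y∉ ∘ proj₁)))
        (+-identityˡ _))

  -- Once `y` is a possible message, only the memberships `z ∈ y` and `z′ ∈ y` matter. The bound is
  -- an equality when `y` contains `z` but not `z′`; the remaining cases rely on `1 ≤ exp ε`.
  SS-isLDP : ∀ {W : List A} → Unique W → ∀ {z z′} → z ∈ W → z′ ∈ W → ∀ y →
             Pr _≟ᴸ_ (SS 0≤ε z W) y ≤ e * Pr _≟ᴸ_ (SS 0≤ε z′ W) y
  SS-isLDP {W} W! {z} {z′} z∈W z′∈W y = bound
    where
    n = length (remove _≟_ z′ W)
    d = subsetSize ε (suc n)

    |others| : length (remove _≟_ z W) ≡ n
    |others| = ℕ.suc-injective (≡.trans (≡.sym (length-remove _≟_ W! z∈W)) (length-remove _≟_ W! z′∈W))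

    π π′ : Carrier
    π  = Pr _≟ᴸ_ (SS 0≤ε z W) y
    π′ = Pr _≟ᴸ_ (SS 0≤ε z′ W) y

    Pr-nonNeg : ∀ {ν : Dist (List A)} → 0# ≤ Pr _≟ᴸ_ ν y
    Pr-nonNeg {ν} = go (nonNeg ν)
      where
      go : ∀ {xs} → All (λ wa → 0# ≤ proj₁ wa) xs → 0# ≤ total (filter (λ wa → proj₂ wa ≟ᴸ y) xs)
      go [] = ≤.refl
      go {(w , a) ∷ xs} (0≤w ∷ 0≤ws) with a ≟ᴸ y
      ... | yes _ = +-nonNeg 0≤w (go 0≤ws)
      ... | no  _ = go 0≤ws

    same : π ≈ π′ → π ≤ e * π′
    same π≈π′ = ≤.≤-respˡ-≈ (sym π≈π′) (x≤cx 1≤e (Pr-nonNeg {SS 0≤ε z′ W}))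

    -- The formulas for `z` count the elements other than `z`; they are re-indexed by `n`, which
    -- counts those other than `z′`.
    π-in : y ∈ combinations d W → z ∈ y → π ≈ inWeight d n
    π-in = ≡.subst (λ m → y ∈ combinations (subsetSize ε (suc m)) W → z ∈ y → π ≈ inWeight (subsetSize ε (suc m)) m)
      |others| (Pr-SS-in W! z∈W y)

    π-out : y ∈ combinations d W → z ∉ y → π ≈ outWeight d n
    π-out = ≡.subst (λ m → y ∈ combinations (subsetSize ε (suc m)) W → z ∉ y → π ≈ outWeight (subsetSize ε (suc m)) m)
      |others| (Pr-SS-out W! z∈W y)

    π-invalid : y ∉ combinations d W → π ≈ 0#
    π-invalid = ≡.subst (λ m → y ∉ combinations (subsetSize ε (suc m)) W → π ≈ 0#) |others| (Pr-SS-invalid W! z∈W y)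

    -- A message containing exactly one of z and z′ has between 1 and |W| - 1 elements.
    in≈e*out : ∀ {u v} → v ∈ W → u ∈ y → v ∉ y → y ∈ combinations d W → inWeight d n ≈ e * outWeight d n
    in≈e*out {u} {v} v∈W u∈y v∉y y∈ = inWeight≈e*outWeight d≢0 d≤n
      where
      |y| : length y ≡ d
      |y| = proj₂ (∈-combinations⁻ d W y∈)
      d≢0 : d ≢ 0
      d≢0 d≡0 = nonempty u∈y (≡.trans |y| d≡0)
        where
        nonempty : ∀ {xs : List A} → u ∈ xs → length xs ≢ 0
        nonempty (here _)  ()
        nonempty (there _) ()
      d≤n : d ℕ.≤ n
      d≤n = ≡.subst₂ ℕ._≤_ |y| (ℕ.suc-injective (≡.trans (≡.sym (length-remove _≟_ W! v∈W)) (length-remove _≟_ W! z′∈W)))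
        (Sublist.length-mono-≤ (proj₁ (y⊑others W! v∈W y {d} y∈ v∉y)))

    bound : π ≤ e * π′
    bound with y ∈ᴸ? combinations d W | z ∈? y | z′ ∈? y
    ... | no  y∉ | _      | _       = same (trans (π-invalid y∉) (sym (Pr-SS-invalid W! z′∈W y y∉)))
    ... | yes y∈ | yes z∈ | yes z′∈ = same (trans (π-in y∈ z∈) (sym (Pr-SS-in W! z′∈W y y∈ z′∈)))
    ... | yes y∈ | no  z∉ | no  z′∉ = same (trans (π-out y∈ z∉) (sym (Pr-SS-out W! z′∈W y y∈ z′∉)))
    ... | yes y∈ | yes z∈ | no  z′∉ = ≤.reflexive
      (trans (π-in y∈ z∈) (trans (in≈e*out z′∈W z∈ z′∉ y∈) (*-congˡ (sym (Pr-SS-out W! z′∈W y y∈ z′∉)))))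
    -- Here π′ = e π, so π ≤ e π = π′ ≤ e π′.
    ... | yes y∈ | no  z∉ | yes z′∈ =
      ≤.trans (x≤cx 1≤e (Pr-nonNeg {SS 0≤ε z W}))
        (≤.≤-respˡ-≈ (trans (Pr-SS-in W! z′∈W y y∈ z′∈) (trans (in≈e*out z∈W z′∈ z∉ y∈) (*-congˡ (sym (π-out y∈ z∉)))))
          (x≤cx 1≤e (Pr-nonNeg {SS 0≤ε z′ W})))

-- Tracing sampled keys back to positions of items.

module Locate (ℝ : Reals) {Item A : Set} (_≟_ : DecidableEquality A) (key : Item → Maybe A) where

  open LDP ℝ using (Selection; selected)

  private
    _≟ᵐ_ : DecidableEquality (Maybe A)
    _≟ᵐ_ = Maybe.≡-dec _≟_

  module _ (S : List Item) where

    -- Several items may share a key. Any of them serves, since the randomizer will see an item only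
    -- through its key.
    locate : A → Maybe (Fin (length S))
    locate t with Any.any? (λ x → key x ≟ᵐ just t) S
    ... | yes p = just (Any.index p)
    ... | no  _ = nothing

    locate-sound : ∀ t {i} → locate t ≡ just i → key (List.lookup S i) ≡ just t
    locate-sound t eq with Any.any? (λ x → key x ≟ᵐ just t) S
    locate-sound t ≡.refl | yes p = Any.lookup-index p

    locate-complete : ∀ t → Any (λ x → key x ≡ just t) S → (Maybe.map (List.lookup S) (locate t) Maybe.>>= key) ≡ just t
    locate-complete t p with Any.any? (λ x → key x ≟ᵐ just t) S
    ... | yes q = Any.lookup-index q
    ... | no ¬q = contradiction p ¬q

    private
      slots : ∀ {b} → Vec (Maybe A) b → Vec (Maybe (Fin (length S))) b
      slots = Vec.map (Maybe._>>= locate)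

      -- The condition `distinct` of a `Selection`, rephrased without the common position `i`, so
      -- that a finite search over pairs of slots decides it.
      Distinct : ∀ {b} → Vec (Maybe (Fin (length S))) b → Set
      Distinct σ = ∀ k l → Vec.lookup σ k ≡ Vec.lookup σ l → k ≡ l ⊎ Vec.lookup σ k ≡ nothing

      distinct? : ∀ {b} (σ : Vec (Maybe (Fin (length S))) b) → Dec (Distinct σ)
      distinct? σ = Fin.all? λ k → Fin.all? λ l →
        Maybe.≡-dec Fin._≟_ (Vec.lookup σ k) (Vec.lookup σ l) →-dec
        ((k Fin.≟ l) ⊎-dec Maybe.≡-dec Fin._≟_ (Vec.lookup σ k) nothing)

    -- The selection is empty on vectors with repetitions, which no sampler produces.
    choose : ∀ {b} → Vec (Maybe A) b → Selection S b
    choose v with distinct? (slots v)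
    ... | yes d = record
      { slots    = slots v
      ; distinct = λ k l eqₖ eqₗ →
          [ id , (λ eq → contradiction (≡.trans (≡.sym eqₖ) eq) λ ()) ]′ (d k l (≡.trans eqₖ (≡.sym eqₗ)))
      }
    ... | no _ = record
      { slots    = Vec.replicate _ nothing
      ; distinct = λ k _ eqₖ _ → contradiction (≡.trans (≡.sym eqₖ) (Vec.lookup-replicate k nothing)) λ ()
      }

    record Sound {b} (v : Vec (Maybe A) b) : Set where
      field
        member   : ∀ k {t} → Vec.lookup v k ≡ just t → Any (λ x → key x ≡ just t) S
        distinct : ∀ k l {t} → Vec.lookup v k ≡ just t → Vec.lookup v l ≡ just t → k ≡ l

    -- A position has a single key, so two slots located at the same position held the same key, and
    -- `v` does not repeat keys.
    slots-distinct : ∀ {b} {v : Vec (Maybe A) b} → Sound v → Distinct (slots v)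
    slots-distinct {v = v} sound k l eq
      rewrite Vec.lookup-map k (Maybe._>>= locate) v | Vec.lookup-map l (Maybe._>>= locate) v
      with Vec.lookup v k in eqₖ | Vec.lookup v l in eqₗ
    ... | nothing | _       = inj₂ ≡.refl
    ... | just t  | nothing = inj₂ eq
    ... | just t  | just u with locate t in eqₜ
    ...   | nothing = inj₂ ≡.refl
    ...   | just i
      with ≡.refl ← ≡.trans (≡.sym (locate-sound t eqₜ)) (locate-sound u (≡.sym eq))
      = inj₁ (Sound.distinct sound k l eqₖ eqₗ)

    -- This lets a randomizer that receives items act on exactly the keys that were sampled.
    selected-choose : ∀ {b} {v : Vec (Maybe A) b} → Sound v →
                      Vec.map (Maybe._>>= key) (selected (choose v)) ≡ v
    selected-choose {v = v} sound with distinct? (slots v)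
    ... | no ¬d = contradiction (slots-distinct sound) ¬d
    ... | yes _ = Pointwise-≡⇒≡ (ext pointwise)
      where
      pointwise : ∀ k → Vec.lookup (Vec.map (Maybe._>>= key) (Vec.map (Maybe.map (List.lookup S)) (slots v))) k
                      ≡ Vec.lookup v k
      pointwise k
        rewrite Vec.lookup-map k (Maybe._>>= key) (Vec.map (Maybe.map (List.lookup S)) (slots v))
              | Vec.lookup-map k (Maybe.map (List.lookup S)) (slots v)
              | Vec.lookup-map k (Maybe._>>= locate) v
        with Vec.lookup v k in eqₖ
      ... | nothing = ≡.refl
      ... | just t  = locate-complete t (Sound.member sound k eqₖ)

-- What the two local samplers have in common.

module Sampling (ℝ : Reals) {A : Set} (_≟_ : DecidableEquality A) where
  open Reals ℝ
  open Probability ℝ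
  open Expectation ℝ
  open LocalSampling ℝ _≟_

  pad-member : ∀ B (T : List A) k {t} → Vec.lookup (pad B T) k ≡ just t → t ∈ T
  pad-member (suc B) []      zero    ()
  pad-member (suc B) []      (suc k) eq     = pad-member B [] k eq
  pad-member (suc B) (x ∷ T) zero    ≡.refl = here ≡.refl
  pad-member (suc B) (x ∷ T) (suc k) eq     = there (pad-member B T k eq)

  pad-distinct : ∀ B {T : List A} → Unique T → ∀ k l {t} →
                 Vec.lookup (pad B T) k ≡ just t → Vec.lookup (pad B T) l ≡ just t → k ≡ l
  pad-distinct (suc B) []         zero    _       ()
  pad-distinct (suc B) []         (suc _) zero    _  ()
  pad-distinct (suc B) []         (suc k) (suc l) p  q = ≡.cong suc (pad-distinct B [] k l p q)
  pad-distinct (suc B) (_ ∷ _)    zero    zero    _  _ = ≡.refl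
  pad-distinct (suc B) (x∉ ∷ _)   zero    (suc l) ≡.refl q = contradiction ≡.refl (All.lookup x∉ (pad-member B _ l q))
  pad-distinct (suc B) (x∉ ∷ _)   (suc k) zero    p ≡.refl = contradiction ≡.refl (All.lookup x∉ (pad-member B _ k p))
  pad-distinct (suc B) (_ ∷ T!)   (suc k) (suc l) p  q = ≡.cong suc (pad-distinct B T! k l p q)

  -- Both samplers pad a repetition-free list of elements of `L`: the greedy one by `IsTop`, the
  -- random one because it draws a sublist of the deduplicated `L`.
  E-sample-cong : ∀ s B L {f g : Vec (Maybe A) B → Carrier} →
                  (∀ T → Unique T → T ⊆ L → f (pad B T) ≈ g (pad B T)) → E (sample s B L) f ≈ E (sample s B L) g
  E-sample-cong s B L {f} {g} f≈g = go s
    where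
    through : ∀ {P : List A → Set} (μ : Dist (List A)) → Surely P μ → (∀ {T} → P T → Unique T × T ⊆ L) →
              E (μ >>= λ T → return (pad B T)) f ≈ E (μ >>= λ T → return (pad B T)) g
    through μ sure ok = trans (E->>=-return μ (pad B) f) (trans
      (E-cong-surely μ sure λ T p → f≈g T (proj₁ (ok p)) (proj₂ (ok p)))
      (sym (E->>=-return μ (pad B) g)))
    go : ∀ s → E (sample s B L) f ≈ E (sample s B L) g
    go (GreedySampling rule) = through (GreedyRule.pick rule B L) (GreedyRule.isTop rule B L)
      λ top → IsTop.unique top , IsTop.contributed top
    go RandomSampling = through (randomSubset B (distinctElements L)) (surely-randomSubset B id)
      λ T⊑ → ⊑-unique T⊑ (DecUnique.deduplicate-! _≟_ L) , ∈.∈-deduplicate⁻ _≟_ L ∘ Sublist.lookup T⊑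

-- LDP TrieHH as an interactive protocol.

module Interaction
  (ℝ : Reals)
  {κ : ℕ} (eos : Fin κ) (M : ℕ) (𝒱 : List (String κ))
  (D N B η : ℕ)
  {ε : Reals.Carrier ℝ} (0≤ε : Reals._≤_ ℝ (Reals.0# ℝ) ε)
  (sampler : LocalSampling.LocalSampler ℝ (_≟ˢ_ {κ}))
  where

  open Reals ℝ
  open Probability ℝ
  open Expectation ℝ
  open LDP ℝ
  open LocalSampling ℝ (_≟ˢ_ {κ})
  open Sampling ℝ (_≟ˢ_ {κ})
  open SubsetSelection ℝ (Maybe.≡-dec (_≟ˢ_ {κ}))
  open SubsetSelectionLDP ℝ (Maybe.≡-dec (_≟ˢ_ {κ})) 0≤ε using (_≟ᴸ_; SS-isLDP)
  open TrieHH ℝ eos 𝒱 D N B η 0≤ε sampler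
  open DecMembership (_≟ˢ_ {κ}) using (_∈?_; _∉?_)
  open DecMembership (Fin._≟_ {M}) using () renaming (_∉?_ to _∉ᵁ?_)

  -- Subset selection needs a repetition-free listing of its domain; extension and pruning preserve
  -- this from layer to layer, because a string determines its last character and the rest.
  extensions-unique : ∀ {P} → Unique P → Unique (extensions P)
  extensions-unique P! = Unique.cartesianProductWith⁺ List._∷ʳ_ (λ {w} {x} → List.∷ʳ-injective w x) P! (Unique.allFin⁺ κ)

  prune-unique : ∀ {Z} → Unique Z → (v : Votes Z) → Unique (prune Z v)
  prune-unique {Z} Z! v = Unique.map⁺ (lookup-injective Z!) (Unique.filter⁺ _ (Unique.allFin⁺ (length Z)))

  -- The exclusion of `𝒱` stays with the sampling: should the item located for a sampled prefix lie
  -- in `𝒱`, it still has that prefix and so gives the same message.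
  prefixIn : ℕ → List (String κ) → Contribution eos → Maybe (String κ)
  prefixIn i Z (z , _) with List.take (suc i) z ∈? Z
  ... | yes _ = just (List.take (suc i) z)
  ... | no  _ = nothing

  withDummy : List (String κ) → List (Maybe (String κ))
  withDummy Z = nothing ∷ List.map just Z

  withDummy-unique : ∀ {Z} → Unique Z → Unique (withDummy Z)
  withDummy-unique {Z} Z! = All.map⁺ (All.universal (λ _ ()) Z) ∷ Unique.map⁺ Maybe.just-injective Z!

  prefixIn∈ : ∀ i Z m → (m Maybe.>>= prefixIn i Z) ∈ withDummy Z
  prefixIn∈ i Z nothing = here ≡.refl
  prefixIn∈ i Z (just (z , _)) with List.take (suc i) z ∈? Z
  ... | yes z∈ = there (∈.∈-map⁺ just z∈)
  ... | no  _  = here ≡.refl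

  ∈-localPrefixes⁻ : ∀ i Z S {t} → t ∈ localPrefixes i Z S → Any (λ x → prefixIn i Z x ≡ just t) S
  ∈-localPrefixes⁻ i Z S t∈ with ∈.∈-filter⁻ (_∈? Z) {xs = List.map (List.take (suc i)) (filter (_∉? 𝒱) (List.map proj₁ S))} t∈
  ... | t∈map , t∈Z with ∈.∈-map⁻ (List.take (suc i)) t∈map
  ...   | z , z∈ , ≡.refl with ∈.∈-map⁻ proj₁ (proj₁ (∈.∈-filter⁻ (_∉? 𝒱) {xs = List.map proj₁ S} z∈))
  ...     | x , x∈S , ≡.refl = Any.map (λ { ≡.refl → prefix x t∈Z }) x∈S
    where
    prefix : ∀ x → List.take (suc i) (proj₁ x) ∈ Z → prefixIn i Z x ≡ just (List.take (suc i) (proj₁ x))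
    prefix (z , _) t∈Z with List.take (suc i) z ∈? Z
    ... | yes _  = ≡.refl
    ... | no  t∉ = contradiction t∈Z t∉

  module _ (i : ℕ) {Z : List (String κ)} (Z! : Unique Z) where

    open Locate ℝ _≟ˢ_ (prefixIn i Z)

    randomizer : Randomizer ε (Contribution eos)
    randomizer = record
      { Message   = List (Maybe (String κ))
      ; _≟_       = _≟ᴸ_
      ; randomize = λ m → SS 0≤ε (m Maybe.>>= prefixIn i Z) (withDummy Z)
      ; isLDP     = λ x x′ → SS-isLDP (withDummy-unique Z!) (prefixIn∈ i Z x) (prefixIn∈ i Z x′)
      }

    report : (S : List (Contribution eos)) → Dist (Selection S B)
    report S = sample sampler B (localPrefixes i Z S) >>= λ v → return (choose S v)

    votes : Vec (List (Maybe (String κ))) B → Votes Z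
    votes As = Vec.foldr′ _⊕_ noVotes (Vec.map (indicator Z) As)

    -- The votes are a function of the B messages, so they become post-processing; `h` will stand
    -- for everything that happens after this user.
    E-report : ∀ S (h : Votes Z → Carrier) →
      E (userVotes i Z S) h ≈
      E (report S) (λ σ → E (mapM (randomize randomizer) (selected σ)) (h ∘ votes))
    E-report S h = begin
      E (userVotes i Z S) h
        ≈⟨ E->>= (sample sampler B L) (λ S̃ → mapM ss S̃ >>= λ As → return (votes As)) h ⟩
      E (sample sampler B L) (λ v → E (mapM ss v >>= λ As → return (votes As)) h)
        ≈⟨ E-cong (sample sampler B L) (λ v → E->>=-return (mapM ss v) votes h) ⟩
      E (sample sampler B L) (λ v → E (mapM ss v) (h ∘ votes))
        -- The sampled prefixes are exchanged for the prefixes of the located items; on each padded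
        -- list that can be sampled the message distributions are identical.
        ≈⟨ E-sample-cong sampler B L (λ T T! T⊆L → reflexive (≡.cong (λ μ → E μ (h ∘ votes)) (same T! T⊆L))) ⟩
      E (sample sampler B L) (λ v → E (mapM (randomize randomizer) (selected (choose S v))) (h ∘ votes))
        ≈⟨ E->>=-return (sample sampler B L) (choose S) _ ⟨
      E (report S) (λ σ → E (mapM (randomize randomizer) (selected σ)) (h ∘ votes)) ∎
      where
      open ≈-Reasoning setoid
      L  = localPrefixes i Z S
      ss : Maybe (String κ) → Dist (List (Maybe (String κ)))
      ss m = SS 0≤ε m (withDummy Z)
      same : ∀ {T} → Unique T → T ⊆ L → mapM ss (pad B T) ≡ mapM (randomize randomizer) (selected (choose S (pad B T)))
      same {T} T! T⊆L = ≡.trans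
        (≡.cong (mapM ss) (≡.sym (selected-choose S (record
          { member   = λ k eq → ∈-localPrefixes⁻ i Z S (T⊆L (pad-member B T k eq))
          ; distinct = pad-distinct B T!
          }))))
        (≡.sym (mapM-map ss (Maybe._>>= prefixIn i Z) (selected (choose S (pad B T)))))

  -- Follows the growth of `asked` under successive uses of `ask`, hence says both that the users
  -- are new and that they are distinct.
  Fresh : List (Fin M) → List (Fin M) → Set
  Fresh []      asked = ⊤
  Fresh (j ∷ U) asked = j ∉ asked × Fresh U (j ∷ asked)

  fresh? : ∀ U asked → Dec (Fresh U asked)
  fresh? []      asked = yes tt
  fresh? (j ∷ U) asked = (j ∉ᵁ? asked) ×-dec fresh? U (j ∷ asked)

  fresh⁺ : ∀ {U asked} → Unique U → (∀ {j} → j ∈ U → j ∉ asked) → Fresh U asked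
  fresh⁺ []       _   = tt
  fresh⁺ (j∉U ∷ U!) new = new (here ≡.refl) , fresh⁺ U! λ
    { j∈U (here ≡.refl) → All.lookup j∉U j∈U ≡.refl
    ; j∈U (there j∈)    → new (there j∈U) j∈ }

  Out : Set
  Out = List (String κ)

  -- Each `ask` conses its user onto the index, which reverses the order of `U`; with `ʳ++` the
  -- index computes and needs no transport.
  askAll : ∀ i {Z} → Unique Z → ∀ {asked} U → Fresh U asked →
           (Vec (Votes Z) (length U) → Protocol ε (Contribution eos) Out (U ʳ++ asked)) →
           Protocol ε (Contribution eos) Out asked
  askAll i Z! []      _            next = next []
  askAll i Z! (j ∷ U) (j∉ , fresh) next =
    ask j j∉ B (report i Z!) (randomizer i Z!) λ ms →
    askAll i Z! U fresh λ vs → next (votes i Z! ms ∷ vs)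

  -- The continuation of `toss` has to be defined on all lists of users, also on those that sampling
  -- cannot return; these end with an arbitrary output.
  whenFresh : ∀ {asked U} → Dec (Fresh U asked) → (Fresh U asked → Protocol ε (Contribution eos) Out asked) →
              Protocol ε (Contribution eos) Out asked
  whenFresh (yes fresh) π = π fresh
  whenFresh (no _)      _ = output []

  mutual

    -- `participated` is carried next to the index `asked`, so that users are drawn from literally
    -- the same distribution as in `layers`, whatever the order in which they were asked.
    layersProtocol : (n i : ℕ) {P : List (String κ)} → Unique P → (asked participated : List (Fin M)) → Out →
                     Protocol ε (Contribution eos) Out asked
    layersProtocol zero    i P! asked participated H = output H
    layersProtocol (suc n) i P! asked participated H =
      toss (randomSubset N (filter (_∉ᵁ? participated) (allFin M))) (layerProtocol n i P! asked participated H)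

    layerProtocol : (n i : ℕ) {P : List (String κ)} → Unique P → (asked participated : List (Fin M)) → Out →
                    List (Fin M) → Protocol ε (Contribution eos) Out asked
    layerProtocol n i P! asked participated H U = whenFresh (fresh? U asked) λ fresh →
      askAll i (extensions-unique P!) U fresh (nextProtocol n i P! asked participated H U)

    nextProtocol : (n i : ℕ) {P : List (String κ)} → Unique P → (asked participated : List (Fin M)) → Out →
                   (U : List (Fin M)) → Vec (Votes (extensions P)) (length U) →
                   Protocol ε (Contribution eos) Out (U ʳ++ asked)
    nextProtocol n i {P} P! asked participated H U vs =
      layersProtocol n (suc i) (prune-unique (extensions-unique P!) v) (U ʳ++ asked) (U ++ participated)
        (H ++ filter (endsIn? eos) (prune (extensions P) v))
      where v = Vec.foldr′ _⊕_ noVotes vs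

  module _ (S : Fin M → List (Contribution eos)) where

    -- The decision is a variable here, so that it can be matched on. The equation is required for
    -- every proof of freshness because `π` receives the one found by the decision.
    E-whenFresh : ∀ {asked U} (d : Dec (Fresh U asked)) → Fresh U asked → ∀ π f {c} →
                  (∀ fresh → c ≈ E (run (π fresh) S) f) → c ≈ E (run (whenFresh d π) S) f
    E-whenFresh (yes fresh) _     π f eq = eq fresh
    E-whenFresh (no ¬fresh) fresh π f eq = contradiction fresh ¬fresh

    -- Induction on the users. For each, `E-report` is applied to the expected result `h` of the
    -- remaining users and layers, which is why it must hold for arbitrary functions.
    E-askAll : ∀ i {Z} (Z! : Unique Z) {asked} U (fresh : Fresh U asked) next f →
               E (run (askAll i Z! U fresh next) S) f ≈
               E (mapM (λ j → userVotes i Z (S j)) (Vec.fromList U)) (λ vs → E (run (next vs) S) f)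
    E-askAll i Z! []      _            next f = sym (E-return [] (λ vs → E (run (next vs) S) f))
    E-askAll i {Z} Z! (j ∷ U) (j∉ , fresh) next f = begin
      E (run (askAll i Z! (j ∷ U) (j∉ , fresh) next) S) f
        ≈⟨ E->>= (report i Z! (S j)) (λ σ → mapM (randomize R) (selected σ) >>= λ ms → run (rest ms) S) f ⟩
      E (report i Z! (S j)) (λ σ → E (mapM (randomize R) (selected σ) >>= λ ms → run (rest ms) S) f)
        ≈⟨ E-cong (report i Z! (S j)) (λ σ → trans
             (E->>= (mapM (randomize R) (selected σ)) (λ ms → run (rest ms) S) f)
             (E-cong (mapM (randomize R) (selected σ)) λ ms →
               E-askAll i Z! U fresh (λ vs → next (votes i Z! ms ∷ vs)) f)) ⟩
      E (report i Z! (S j)) (λ σ → E (mapM (randomize R) (selected σ)) (h ∘ votes i Z!))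
        ≈⟨ E-report i Z! (S j) h ⟨
      E (userVotes i Z (S j)) h
        ≈⟨ E-mapM-∷ (λ j → userVotes i Z (S j)) j (Vec.fromList U) (λ vs → E (run (next vs) S) f) ⟨
      E (mapM (λ j → userVotes i Z (S j)) (Vec.fromList (j ∷ U))) (λ vs → E (run (next vs) S) f) ∎
      where
      open ≈-Reasoning setoid
      R = randomizer i Z!
      rest : Vec (List (Maybe (String κ))) B → Protocol ε (Contribution eos) Out (j ∷ _)
      rest ms = askAll i Z! U fresh λ vs → next (votes i Z! ms ∷ vs)
      h : Votes Z → Carrier
      h v = E (mapM (λ j → userVotes i Z (S j)) (Vec.fromList U)) (λ vs → E (run (next (v ∷ vs)) S) f)

    -- Sampled users lie outside `participated`, so the inclusion of `asked` in it makes them fresh,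
    -- and the default of `whenFresh` is never compared with the algorithm.
    E-layers : ∀ n i {P} (P! : Unique P) {asked participated} → asked ⊆ participated → ∀ H f →
               E (layers S n i P participated H) f ≈ E (run (layersProtocol n i P! asked participated H) S) f
    E-layers zero    i     P! asked⊆ H f = refl
    E-layers (suc n) i {P} P! {asked} {participated} asked⊆ H f = begin
      E (layers S (suc n) i P participated H) f
        ≈⟨ E->>= μ (λ U → aggregateVotes S i Z U >>= next U) f ⟩
      E μ (λ U → E (aggregateVotes S i Z U >>= next U) f)
        ≈⟨ E-cong-surely μ (surely-randomSubset N id) layer ⟩
      E μ (λ U → E (run (protocol U) S) f)
        ≈⟨ E->>= μ (λ U → run (protocol U) S) f ⟨
      E (run (layersProtocol (suc n) i P! asked participated H) S) f ∎
      where
      open ≈-Reasoning setoid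
      Z  = extensions P
      Z! = extensions-unique P!
      continue  = nextProtocol n i P! asked participated H
      protocol  = layerProtocol n i P! asked participated H
      available = filter (_∉ᵁ? participated) (allFin M)
      μ  = randomSubset N available
      next : List (Fin M) → Votes Z → Dist Out
      next U v = layers S n (suc i) (prune Z v) (U ++ participated) (H ++ filter (endsIn? eos) (prune Z v))
      layer : ∀ U → U ⊑ available → E (aggregateVotes S i Z U >>= next U) f ≈ E (run (protocol U) S) f
      layer U U⊑ = trans
        (begin
          E (aggregateVotes S i Z U >>= next U) f
            ≈⟨ E->>= (aggregateVotes S i Z U) (next U) f ⟩
          E (aggregateVotes S i Z U) (λ v → E (next U v) f)
            ≈⟨ E->>=-return users (Vec.foldr′ _⊕_ noVotes) (λ v → E (next U v) f) ⟩
          E users (λ vs → E (next U (Vec.foldr′ _⊕_ noVotes vs)) f)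
            ≈⟨ E-cong users (λ vs → E-layers n (suc i) (prune-unique Z! (Vec.foldr′ _⊕_ noVotes vs)) asked⊆′
                 (H ++ filter (endsIn? eos) (prune Z (Vec.foldr′ _⊕_ noVotes vs))) f) ⟩
          E users (λ vs → E (run (continue U vs) S) f) ∎)
        (E-whenFresh (fresh? U asked) (fresh⁺ U! new) (λ fresh → askAll i Z! U fresh (continue U)) f
          λ fresh → sym (E-askAll i Z! U fresh (continue U) f))
        where
        users = mapM (λ j → userVotes i Z (S j)) (Vec.fromList U)
        U! : Unique U
        U! = ⊑-unique U⊑ (Unique.filter⁺ (_∉ᵁ? participated) (Unique.allFin⁺ M))
        new : ∀ {j} → j ∈ U → j ∉ asked
        new j∈U = proj₂ (∈.∈-filter⁻ (_∉ᵁ? participated) {xs = allFin M} (Sublist.lookup U⊑ j∈U)) ∘ asked⊆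
        asked⊆′ : U ʳ++ asked ⊆ U ++ participated
        asked⊆′ v∈ with ∈.∈-++⁻ U (ʳ++-⊆-++ U v∈)
        ... | inj₁ v∈U     = ∈.∈-++⁺ˡ v∈U
        ... | inj₂ v∈asked = ∈.∈-++⁺ʳ U (asked⊆ v∈asked)

  singletons-unique : Unique (List.map [_] (allFin κ))
  singletons-unique = Unique.map⁺ List.∷-injectiveˡ (Unique.allFin⁺ κ)

  trieHH-isItemLevelLDP : ItemLevelLDP ε {Contribution eos} {M = M} _≟ᴴ_ trieHH
  trieHH-isItemLevelLDP = protocol , λ S o → trans (Pr≈E _≟ᴴ_ (trieHH S) o)
    (trans (E-layers S D 1 singletons-unique id [] (λ a → 𝟙 (a ≟ᴴ o))) (sym (Pr≈E _≟ᴴ_ (run protocol S) o)))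
    where
    protocol : Protocol ε (Contribution eos) Out {M} []
    protocol = layersProtocol D 1 singletons-unique [] [] []

theorem1 : (ℝ : Reals) {κ : ℕ} (eos : Fin κ) (M : ℕ) (𝒱 : List (String κ))
    (D N B ηmax : ℕ) {ε : Reals.Carrier ℝ} (0≤ε : Reals._≤_ ℝ (Reals.0# ℝ) ε)
    (sampler : LocalSampling.LocalSampler ℝ (_≟ˢ_ {κ})) →
    LDP.ItemLevelLDP ℝ ε {Contribution eos} {List (String κ)} {M} _≟ᴴ_
    (TrieHH.trieHH ℝ eos 𝒱 D N B ηmax 0≤ε sampler)
theorem1 ℝ eos M 𝒱 D N B ηmax 0≤ε sampler = Interaction.trieHH-isItemLevelLDP ℝ eos M 𝒱 D N B ηmax 0≤ε sampler
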